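{- For all $n\ge7$ there are two distinct maximal $K_{2,3}$-matroids on $K_n$ (maximal with respect to the weak order).
   Context: A $K_{2,3}$-matroid on $K_n$ is a matroid on $E(K_n)$ in which the edge set of every subgraph isomorphic to $K_{2,3}$ is a circuit. Weak order: ${\mathcal M}_1\preceq{\mathcal M}_2$ if every independent set of ${\mathcal M}_1$ is independent in ${\mathcal M}_2$. -}

module Defs where

open import Data.Nat using (ℕ; _+_; _<_)
open import Data.Bool using (Bool; true; false; T; if_then_else_; _∨_; _∧_)
open import Data.Fin using (Fin; _<?_; _≟_)
import Data.Fin as F
open import Data.Fin.Properties using () renaming (_≟_ to _≟F_)
open import Data.List using (List; []; _∷_; concatMap; map; allFin)
open import Data.Nat.ListAction using (sum)
open import Data.Bool.ListAction using (any)
open import Data.Product using (Σ; Σ-syntax; ∃; ∃-syntax; _×_; _,_; proj₁; proj₂)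
open import Relation.Nullary using (¬_; yes; no)
open import Relation.Nullary.Decidable using (⌊_⌋)
open import Relation.Binary.PropositionalEquality using (_≡_)
open import Function.Definitions using (Injective)
open import Level using (suc; zero)

-- Edges of the complete graph K_n on vertex set Fin n:
-- an edge {i,j} is stored as the ordered pair (i , j) with i < j.
Edge : ℕ → Set
Edge n = Σ (Fin n × Fin n) (λ p → proj₁ p F.< proj₂ p)

EdgeSet : ℕ → Set
EdgeSet n = Edge n → Bool

∅ : ∀ {n} → EdgeSet n
∅ _ = false

_∈_ : ∀ {n} → Edge n → EdgeSet n → Set
e ∈ X = T (X e)

_⊆_ : ∀ {n} → EdgeSet n → EdgeSet n → Set
X ⊆ Y = ∀ e → e ∈ X → e ∈ Y

-- X ∪ {e}  (two edges are equal iff their vertex pairs are equal)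
insert : ∀ {n} → Edge n → EdgeSet n → EdgeSet n
insert ((a , b) , _) X ((c , d) , lt) =
  (⌊ c ≟F a ⌋ ∧ ⌊ d ≟F b ⌋) ∨ X ((c , d) , lt)

edgeIf : ∀ {n} → Fin n → Fin n → List (Edge n)
edgeIf i j with i <? j
... | yes i<j = ((i , j) , i<j) ∷ []
... | no _    = []

allEdges : (n : ℕ) → List (Edge n)
allEdges n = concatMap (λ i → concatMap (λ j → edgeIf i j) (allFin n)) (allFin n)

∣_∣ : ∀ {n} → EdgeSet n → ℕ
∣_∣ {n} X = sum (map (λ e → if X e then 1 else 0) (allEdges n))

record Matroid (n : ℕ) : Set₁ where
  field
    Ind        : EdgeSet n → Set
    ind-empty  : Ind ∅
    ind-subset : ∀ {X Y} → X ⊆ Y → Ind Y → Ind X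
    ind-augment : ∀ {X Y} → Ind X → Ind Y → ∣ X ∣ < ∣ Y ∣ →
                  ∃[ e ] (e ∈ Y × ¬ (e ∈ X) × Ind (insert e X))

open Matroid public

IsCircuit : ∀ {n} → Matroid n → EdgeSet n → Set
IsCircuit M C = ¬ Ind M C × (∀ X → X ⊆ C → (∃[ e ] (e ∈ C × ¬ (e ∈ X))) → Ind M X)

-- Edge set of the copy of K_{2,3} in K_n with parts {f 0, f 1} and {f 2, f 3, f 4},
-- where f : Fin 5 → Fin n is injective.
inK23 : ∀ {n} → (Fin 5 → Fin n) → EdgeSet n
inK23 f ((i , j) , _) =
  any (λ p → any (λ q →
        (⌊ i ≟F f p ⌋ ∧ ⌊ j ≟F f q ⌋) ∨ (⌊ i ≟F f q ⌋ ∧ ⌊ j ≟F f p ⌋))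
      (F.suc (F.suc F.zero) ∷ F.suc (F.suc (F.suc F.zero)) ∷ F.suc (F.suc (F.suc (F.suc F.zero))) ∷ []))
    (F.zero ∷ F.suc F.zero ∷ [])

IsK23Matroid : ∀ {n} → Matroid n → Set
IsK23Matroid {n} M = (f : Fin 5 → Fin n) → Injective _≡_ _≡_ f → IsCircuit M (inK23 f)

_⪯_ : ∀ {n} → Matroid n → Matroid n → Set
M₁ ⪯ M₂ = ∀ X → Ind M₁ X → Ind M₂ X

IsMaximalK23 : ∀ {n} → Matroid n → Set₁
IsMaximalK23 {n} M = IsK23Matroid M × ((M' : Matroid n) → IsK23Matroid M' → M ⪯ M' → M' ⪯ M)

{-# OPTIONS --safe #-}
-- The copies of K_{2,3} are 6-sets, no two of which share 5 edges, so they are the circuit-hyperplanes of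
-- a sparse paving matroid P of rank 6. In any K_{2,3}-matroid M above P the six edges of a K₄ are
-- independent. Successive copies of K_{2,3} show that a K₅ has rank at most 6 in M, so the K₄ spans each
-- K₅ containing it, and then every edge. Thus M has rank 6 and P is maximal.
--
-- The bicircular matroid is a K_{2,3}-matroid of rank n ≥ 7. A maximal K_{2,3}-matroid that keeps one of
-- its independent 7-sets independent is different from P. Such a maximal matroid is found
-- constructively by a search over the finitely many families of edge sets, choosing one with the most
-- independent sets; a competing matroid need not be decidable, but it is so up to double negation.
module Submission where

open import Defs
open import Data.Bool using (Bool; true; false; T; if_then_else_; _∧_; _∨_; _xor_; not)
open import Data.Bool.ListAction using (any)
open import Data.Empty using (⊥-elim)
open import Data.Fin using (Fin; zero; suc; toℕ; _↑ˡ_; _↑ʳ_)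
import Data.Fin as F
open import Data.Fin.Patterns using (0F; 1F; 2F; 3F; 4F)
open import Data.Fin.Properties using (_≟_; <-cmp; ↑ˡ-injective; ↑ʳ-injective; all?; suc-injective; pigeonhole)
open import Data.List using (List; []; _∷_; _++_; length; filter; map; concatMap; allFin; cartesianProduct; tabulate)
open import Data.List.Extrema.Nat using (argmax; argmax-all; f[xs]≤f[argmax])
open import Data.List.Membership.Propositional using (find; lose) renaming (_∈_ to _∈ˡ_; _∉_ to _∉ˡ_)
open import Data.List.Membership.Propositional.Properties using (∈-∃++; ∈-++⁺ˡ; ∈-++⁺ʳ; ∈-++⁻; ∈-map⁺; ∈-map⁻; ∈-filter⁺; ∈-filter⁻; ∈-concatMap⁺; ∈-concatMap⁻; ∈-allFin; ∈-cartesianProduct⁺; ∈-tabulate⁻)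
import Data.List.Membership.DecPropositional as DecMembership
open import Data.List.Properties using (length-map; length-++; length-filter)
open import Data.List.Relation.Unary.All as All using (All; []; _∷_)
open import Data.List.Relation.Unary.All.Properties using (all-filter; ¬Any⇒All¬; ¬All⇒Any¬)
open import Data.List.Relation.Unary.AllPairs using ([]; _∷_)
open import Data.List.Relation.Unary.Any as Any using (Any; here; there)
open import Data.List.Relation.Unary.Any.Properties using (any⁺; any⁻)
open import Data.List.Relation.Unary.Unique.Propositional using (Unique)
import Data.List.Relation.Unary.Unique.Propositional.Properties as Unique
open import Data.Nat using (ℕ; zero; suc; _+_; _≤_; _<_; z≤n; s≤s; _≤?_; _<?_)
import Data.Nat as ℕ
open import Data.Nat.DivMod using (_%_)
open import Data.Nat.ListAction using (sum)
open import Data.Nat.Properties using (≤-refl; ≤-trans; ≤-reflexive; ≤-antisym; ≤-pred; ≰⇒>; <⇒≱; <-irrelevant; <-asym; <-irrefl; m≤n⇒m≤1+n; m≤m+n; n≤1+n; n≤0⇒n≡0; +-suc; +-monoʳ-≤)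
open import Data.Product using (Σ; ∃-syntax; _×_; _,_; proj₁; proj₂)
open import Data.Product.Properties using (≡-dec)
open import Data.Sum using (_⊎_; inj₁; inj₂; swap)
open import Data.Vec using (lookup; []; _∷_)
open import Data.Vec.Relation.Unary.All using ([]; _∷_)
open import Data.Vec.Relation.Unary.AllPairs using ([]; _∷_)
import Data.Vec.Relation.Unary.Unique.Propositional.Properties as Vec
open import Function using (_∘_; id)
open import Function.Definitions using (Injective)
open import Relation.Binary.Definitions using (DecidableEquality; tri<; tri≈; tri>)
open import Relation.Binary.PropositionalEquality using (_≡_; _≢_; refl; sym; trans; cong; cong₂; subst; subst₂)
open import Relation.Nullary using (¬_; Dec; yes; no; contradiction)
open import Relation.Nullary.Decidable using (⌊_⌋; T?; True; toWitness; fromWitness; from-yes; ¬?; _×-dec_; _→-dec_; map′; ¬¬-excluded-middle; decidable-stable)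

-- Finite lists

-- Delete from `ys` one occurrence of the head of `xs`; by uniqueness the tail of `xs` still fits
-- into what is left.
unique⊆⇒length≤ : {A : Set} {xs ys : List A} → Unique xs →
                  (∀ {x} → x ∈ˡ xs → x ∈ˡ ys) → length xs ≤ length ys
unique⊆⇒length≤ [] _ = z≤n
unique⊆⇒length≤ {xs = x ∷ xs} u@(_ ∷ uxs) xs⊆ with ∈-∃++ (xs⊆ (here refl))
... | us , vs , refl = subst (suc (length xs) ≤_) (sym eq) (s≤s (unique⊆⇒length≤ uxs drop))
  where
  eq : length (us ++ x ∷ vs) ≡ suc (length (us ++ vs))
  eq = trans (length-++ us) (trans (+-suc _ _) (cong suc (sym (length-++ us))))

  drop : ∀ {y} → y ∈ˡ xs → y ∈ˡ us ++ vs
  drop y∈ with ∈-++⁻ us (xs⊆ (there y∈))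
  ... | inj₁ y∈us         = ∈-++⁺ˡ y∈us
  ... | inj₂ (here refl)  = ⊥-elim (Unique.Unique[x∷xs]⇒x∉xs u y∈)
  ... | inj₂ (there y∈vs) = ∈-++⁺ʳ us y∈vs

-- Injectivity is asked for on the list alone because endpoint assignments of edges are injective
-- only on a given edge set.
map-unique : {A B : Set} {f : A → B} {xs : List A} →
             (∀ {x y} → x ∈ˡ xs → y ∈ˡ xs → f x ≡ f y → x ≡ y) →
             Unique xs → Unique (map f xs)
map-unique                      inj []         = []
map-unique {f = f} {xs = x ∷ _} inj u@(_ ∷ us) =
  ¬Any⇒All¬ _ fresh ∷ map-unique (λ p q → inj (there p) (there q)) us
  where
  fresh : f x ∉ˡ map f _
  fresh fx∈ with ∈-map⁻ f fx∈
  ... | y , y∈ , eq =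
    Unique.Unique[x∷xs]⇒x∉xs u (subst (_∈ˡ _) (sym (inj (here refl) (there y∈) eq)) y∈)

-- Since `key` recovers from an element the block that it comes from, different blocks are disjoint.
concatMap-unique : {A B : Set} (f : A → List B) (key : B → A) {xs : List A} →
                   (∀ {x z} → z ∈ˡ f x → key z ≡ x) → (∀ x → Unique (f x)) →
                   Unique xs → Unique (concatMap f xs)
concatMap-unique f key {[]}     key-f uf []         = []
concatMap-unique f key {x ∷ xs} key-f uf u@(_ ∷ us) =
  Unique.++⁺ (uf x) (concatMap-unique f key key-f uf us) disjoint
  where
  disjoint : ∀ {z} → ¬ (z ∈ˡ f x × z ∈ˡ concatMap f xs)
  disjoint (z∈ , z∈′) with Any.map key-f (∈-concatMap⁻ f {xs = xs} z∈′)
  ... | later = Unique.Unique[x∷xs]⇒x∉xs u (Any.map (λ eq → trans (sym (key-f z∈)) eq) later)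

-- Edges and cardinalities of edge sets

edge-≡ : ∀ {n} {e e′ : Edge n} → proj₁ e ≡ proj₁ e′ → e ≡ e′
edge-≡ {e = p , lt} {.p , lt′} refl = cong (p ,_) (<-irrelevant lt lt′)

_≟ᴱ_ : ∀ {n} → DecidableEquality (Edge n)
e ≟ᴱ e′ = map′ edge-≡ (cong proj₁) (≡-dec _≟_ _≟_ (proj₁ e) (proj₁ e′))

_∈?_ : ∀ {n} (e : Edge n) (l : List (Edge n)) → Dec (e ∈ˡ l)
_∈?_ = DecMembership._∈?_ _≟ᴱ_

∈-allEdges : ∀ {n} (e : Edge n) → e ∈ˡ allEdges n
∈-allEdges ((i , j) , i<j) =
  ∈-concatMap⁺ _ (Any.map (λ { refl → ∈-concatMap⁺ _ (Any.map (λ { refl → ∈-edgeIf }) (∈-allFin j)) })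
                          (∈-allFin i))
  where
  ∈-edgeIf : ((i , j) , i<j) ∈ˡ edgeIf i j
  ∈-edgeIf with i F.<? j
  ... | yes _   = here (edge-≡ refl)
  ... | no  i≮j = contradiction i<j i≮j

∈-edgeIf⁻ : ∀ {n} {i j : Fin n} {e} → e ∈ˡ edgeIf i j → proj₁ e ≡ (i , j)
∈-edgeIf⁻ {i = i} {j} e∈ with i F.<? j | e∈
... | yes _ | here refl = refl

allEdges-unique : ∀ n → Unique (allEdges n)
allEdges-unique n =
  concatMap-unique _ (proj₁ ∘ proj₁) row-key row (Unique.allFin⁺ n)
  where
  edgeIf-unique : ∀ i j → Unique (edgeIf {n} i j)
  edgeIf-unique i j with i F.<? j
  ... | yes _ = [] ∷ []
  ... | no  _ = []

  row : ∀ i → Unique (concatMap (edgeIf i) (allFin n))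
  row i = concatMap-unique _ (proj₂ ∘ proj₁) (cong proj₂ ∘ ∈-edgeIf⁻) (edgeIf-unique i)
                           (Unique.allFin⁺ n)

  row-key : ∀ {i e} → e ∈ˡ concatMap (edgeIf i) (allFin n) → proj₁ (proj₁ e) ≡ i
  row-key {i} e∈ with Any.satisfied (∈-concatMap⁻ (edgeIf i) {xs = allFin n} e∈)
  ... | _ , e∈′ = cong proj₁ (∈-edgeIf⁻ e∈′)

elems : ∀ {n} → EdgeSet n → List (Edge n)
elems {n} X = filter (λ e → T? (X e)) (allEdges n)

∈-elems⁺ : ∀ {n} {X : EdgeSet n} {e} → e ∈ X → e ∈ˡ elems X
∈-elems⁺ {X = X} {e} = ∈-filter⁺ (λ e → T? (X e)) (∈-allEdges e)

∈-elems⁻ : ∀ {n} {X : EdgeSet n} {e} → e ∈ˡ elems X → e ∈ X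
∈-elems⁻ {n} {X} e∈ = proj₂ (∈-filter⁻ (λ e → T? (X e)) {xs = allEdges n} e∈)

elems-unique : ∀ {n} (X : EdgeSet n) → Unique (elems X)
elems-unique X = Unique.filter⁺ (λ e → T? (X e)) (allEdges-unique _)

card≡length : ∀ {n} (X : EdgeSet n) → ∣ X ∣ ≡ length (elems X)
card≡length {n} X = go (allEdges n)
  where
  go : ∀ l → sum (map (λ e → if X e then 1 else 0) l) ≡ length (filter (λ e → T? (X e)) l)
  go []      = refl
  go (e ∷ l) with X e
  ... | true  = cong suc (go l)
  ... | false = go l

length≤card : ∀ {n} (X : EdgeSet n) {l} → Unique l → (∀ {e} → e ∈ˡ l → e ∈ X) → length l ≤ ∣ X ∣
length≤card X u l⊆X =
  subst (_ ≤_) (sym (card≡length X)) (unique⊆⇒length≤ u (∈-elems⁺ {X = X} ∘ l⊆X))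

card≤length : ∀ {n} (X : EdgeSet n) {l} → (∀ {e} → e ∈ X → e ∈ˡ l) → ∣ X ∣ ≤ length l
card≤length X X⊆l =
  subst (_≤ _) (sym (card≡length X)) (unique⊆⇒length≤ (elems-unique X) (X⊆l ∘ ∈-elems⁻ {X = X}))

card-mono : ∀ {n} (X Y : EdgeSet n) → X ⊆ Y → ∣ X ∣ ≤ ∣ Y ∣
card-mono X Y X⊆Y =
  subst (_≤ _) (sym (card≡length X)) (length≤card Y (elems-unique X) (λ {e} e∈ → X⊆Y e (∈-elems⁻ e∈)))

⊆-or-∃∉ : ∀ {n} (X Y : EdgeSet n) → X ⊆ Y ⊎ ∃[ e ] (e ∈ X × ¬ (e ∈ Y))
⊆-or-∃∉ X Y with All.all? (λ e → T? (Y e)) (elems X)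
... | yes X⊆Y = inj₁ λ e e∈ → All.lookup X⊆Y (∈-elems⁺ e∈)
... | no  X⊈Y with find (¬All⇒Any¬ (λ e → T? (Y e)) (elems X) X⊈Y)
...   | e , e∈ , e∉Y = inj₂ (e , ∈-elems⁻ e∈ , e∉Y)

_⊆?_ : ∀ {n} (X Y : EdgeSet n) → Dec (X ⊆ Y)
X ⊆? Y with ⊆-or-∃∉ X Y
... | inj₁ X⊆Y             = yes X⊆Y
... | inj₂ (e , e∈X , e∉Y) = no λ X⊆Y → e∉Y (X⊆Y e e∈X)

card<⇒∃ : ∀ {n} (X Y : EdgeSet n) → ∣ X ∣ < ∣ Y ∣ → ∃[ e ] (e ∈ Y × ¬ (e ∈ X))
card<⇒∃ X Y X<Y with ⊆-or-∃∉ Y X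
... | inj₁ Y⊆X = contradiction (card-mono Y X Y⊆X) (<⇒≱ X<Y)
... | inj₂ new = new

-- Inserting and removing an edge

∨⁺ˡ : ∀ x {y} → T x → T (x ∨ y)
∨⁺ˡ true _ = _

∨⁺ʳ : ∀ x {y} → T y → T (x ∨ y)
∨⁺ʳ true  _ = _
∨⁺ʳ false t = t

∨⁻ : ∀ x {y} → T (x ∨ y) → T x ⊎ T y
∨⁻ true  _ = inj₁ _
∨⁻ false t = inj₂ t

∧⁺ : ∀ x {y} → T x → T y → T (x ∧ y)
∧⁺ true _ t = t

∧⁻ : ∀ x {y} → T (x ∧ y) → T x × T y
∧⁻ true t = _ , t

insert⁺ˡ : ∀ {n} (e : Edge n) (X : EdgeSet n) → e ∈ insert e X
insert⁺ˡ ((a , b) , _) X =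
  ∨⁺ˡ _ (∧⁺ ⌊ a ≟ a ⌋ (fromWitness {a? = a ≟ a} refl) (fromWitness {a? = b ≟ b} refl))

insert⁺ʳ : ∀ {n} (e : Edge n) (X : EdgeSet n) → X ⊆ insert e X
insert⁺ʳ ((a , b) , _) X ((c , d) , _) e∈ = ∨⁺ʳ (⌊ c ≟ a ⌋ ∧ ⌊ d ≟ b ⌋) e∈

insert⁻ : ∀ {n} (e : Edge n) (X : EdgeSet n) {e′} → e′ ∈ insert e X → e′ ≡ e ⊎ e′ ∈ X
insert⁻ ((a , b) , _) X {(c , d) , _} e∈ with ∨⁻ (⌊ c ≟ a ⌋ ∧ ⌊ d ≟ b ⌋) e∈
... | inj₂ e∈X = inj₂ e∈X
... | inj₁ eqs with ∧⁻ ⌊ c ≟ a ⌋ eqs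
...   | p , q = inj₁ (edge-≡ (cong₂ _,_ (toWitness {a? = c ≟ a} p) (toWitness {a? = d ≟ b} q)))

card-insert : ∀ {n} (e : Edge n) (X : EdgeSet n) → ¬ (e ∈ X) → ∣ insert e X ∣ ≡ suc ∣ X ∣
card-insert e X e∉X = trans
  (≤-antisym (card≤length (insert e X) upper)
             (length≤card (insert e X) (¬Any⇒All¬ _ (e∉X ∘ ∈-elems⁻) ∷ elems-unique X) lower))
  (cong suc (sym (card≡length X)))
  where
  upper : ∀ {e′} → e′ ∈ insert e X → e′ ∈ˡ e ∷ elems X
  upper e′∈ with insert⁻ e X e′∈
  ... | inj₁ refl = here refl
  ... | inj₂ e′∈X = there (∈-elems⁺ e′∈X)

  lower : ∀ {e′} → e′ ∈ˡ e ∷ elems X → e′ ∈ insert e X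
  lower (here refl) = insert⁺ˡ e X
  lower (there e′∈) = insert⁺ʳ e X _ (∈-elems⁻ e′∈)

insert-⊆ : ∀ {n} (e : Edge n) (X Y : EdgeSet n) → e ∈ Y → X ⊆ Y → insert e X ⊆ Y
insert-⊆ e X Y e∈Y X⊆Y e′ e′∈ with insert⁻ e X e′∈
... | inj₁ refl = e∈Y
... | inj₂ e′∈X = X⊆Y e′ e′∈X

⊆-card≤⇒⊇ : ∀ {n} (X Y : EdgeSet n) → X ⊆ Y → ∣ Y ∣ ≤ ∣ X ∣ → Y ⊆ X
⊆-card≤⇒⊇ X Y X⊆Y Y≤X e e∈Y with T? (X e)
... | yes e∈X = e∈X
... | no  e∉X = contradiction
  (≤-trans (≤-reflexive (sym (card-insert e X e∉X))) (card-mono (insert e X) Y (insert-⊆ e X Y e∈Y X⊆Y))) (<⇒≱ (s≤s Y≤X))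

⟦_⟧ : ∀ {n} → List (Edge n) → EdgeSet n
⟦ l ⟧ e = ⌊ e ∈? l ⌋

_─_ : ∀ {n} → EdgeSet n → Edge n → EdgeSet n
(X ─ e) e′ = X e′ ∧ not ⌊ e′ ≟ᴱ e ⌋

─⁻ : ∀ {n} (X : EdgeSet n) (e : Edge n) {e′} → e′ ∈ (X ─ e) → e′ ∈ X × e′ ≢ e
─⁻ X e {e′} e′∈ with e′ ≟ᴱ e
... | yes _ = ⊥-elim (proj₂ (∧⁻ (X e′) e′∈))
... | no ne = proj₁ (∧⁻ (X e′) e′∈) , ne

─⁺ : ∀ {n} (X : EdgeSet n) (e : Edge n) {e′} → e′ ∈ X → e′ ≢ e → e′ ∈ (X ─ e)
─⁺ X e {e′} e′∈X ne with e′ ≟ᴱ e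
... | yes eq = contradiction eq ne
... | no  _  = ∧⁺ (X e′) e′∈X _

_∈ᶠ?_ : ∀ {n} (v : Fin n) (l : List (Fin n)) → Dec (v ∈ˡ l)
_∈ᶠ?_ = DecMembership._∈?_ _≟_

-- Spanning in a matroid

-- For independent `I` this is membership of `e` in the closure of `I`, phrased negatively because
-- independence need not be decidable.
Spanned : ∀ {n} → Matroid n → EdgeSet n → Edge n → Set
Spanned M I e = ¬ (e ∈ I) → ¬ Ind M (insert e I)

-- If `Y` were larger, augmentation would add to `I` an element of `Y`, which spanning forbids.
spanned-card : ∀ {n} (M : Matroid n) {I Y : EdgeSet n} → Ind M I → Ind M Y →
               (∀ {e} → e ∈ Y → Spanned M I e) → ∣ Y ∣ ≤ ∣ I ∣
spanned-card M {I} {Y} ind-I ind-Y sp with ∣ Y ∣ ≤? ∣ I ∣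
... | yes Y≤I = Y≤I
... | no  Y≰I with ind-augment M ind-I ind-Y (≰⇒> Y≰I)
...   | e , e∈Y , e∉I , ind = contradiction ind (sp e∈Y e∉I)

-- Augmentation from `W` is repeated until `X` has grown to the size of `W`; `k` bounds the number
-- of rounds.
extend : ∀ {n} (M : Matroid n) (k : ℕ) {X W : EdgeSet n} → Ind M X → Ind M W → ∣ W ∣ ≤ k + ∣ X ∣ →
         ∃[ Y ] (Ind M Y × X ⊆ Y × (∀ {e} → e ∈ Y → e ∈ X ⊎ e ∈ W) × ∣ W ∣ ≤ ∣ Y ∣)
extend M zero    {X} ind-X ind-W le = X , ind-X , (λ _ → id) , inj₁ , le
extend M (suc k) {X} {W} ind-X ind-W le with ∣ W ∣ ≤? ∣ X ∣
... | yes W≤X = X , ind-X , (λ _ → id) , inj₁ , W≤X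
... | no  W≰X with ind-augment M ind-X ind-W (≰⇒> W≰X)
...   | e , e∈W , e∉X , ind with extend M k ind ind-W
          (subst (∣ W ∣ ≤_) (trans (sym (+-suc k ∣ X ∣)) (cong (k +_) (sym (card-insert e X e∉X)))) le)
...     | Y , ind-Y , X+e⊆Y , Y⊆ , W≤Y = Y , ind-Y , (λ e′ → X+e⊆Y e′ ∘ insert⁺ʳ e X e′) , split , W≤Y
  where
  split : ∀ {e′} → e′ ∈ Y → e′ ∈ X ⊎ e′ ∈ W
  split e′∈Y with Y⊆ e′∈Y
  ... | inj₂ e′∈W = inj₂ e′∈W
  ... | inj₁ e′∈X+e with insert⁻ e X e′∈X+e
  ...   | inj₁ refl  = inj₂ e∈W
  ...   | inj₂ e′∈X = inj₁ e′∈X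

-- Suppose `I + e` is independent, and extend `C ─ e` by elements of `I + e` to an independent `Y`
-- with more elements than `I`. Then `e` is not in `Y`, as otherwise `Y` contains `C`. So `Y`
-- consists of elements of `C ─ e` and `I`, all spanned by `I`, and cannot be larger than `I`.
circuit-spans : ∀ {n} (M : Matroid n) {I C : EdgeSet n} {e : Edge n} → Ind M I → IsCircuit M C → e ∈ C →
                (∀ {e′} → e′ ∈ C → e′ ≢ e → Spanned M I e′) → Spanned M I e
circuit-spans M {I} {C} {e} ind-I (dep , proper) e∈C sp e∉I ind-I+e
  with extend M ∣ insert e I ∣ {C ─ e} {insert e I} ind-C─e ind-I+e (m≤m+n _ _)
  where
  ind-C─e : Ind M (C ─ e)
  ind-C─e = proper (C ─ e) (λ _ → proj₁ ∘ ─⁻ C e) (e , e∈C , λ e∈ → proj₂ (─⁻ C e e∈) refl)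
... | Y , ind-Y , C─e⊆Y , Y⊆ , I+e≤Y = contradiction (spanned-card M ind-I ind-Y Y-spanned)
        (<⇒≱ (subst (_≤ ∣ Y ∣) (card-insert e I e∉I) I+e≤Y))
  where
  C⊆Y : e ∈ Y → C ⊆ Y
  C⊆Y e∈Y e′ e′∈C with e′ ≟ᴱ e
  ... | yes refl = e∈Y
  ... | no  ne   = C─e⊆Y e′ (─⁺ C e e′∈C ne)

  Y-spanned : ∀ {e′} → e′ ∈ Y → Spanned M I e′
  Y-spanned {e′} e′∈Y with Y⊆ e′∈Y
  ... | inj₁ e′∈C─e with ─⁻ C e e′∈C─e
  ...   | e′∈C , ne = sp e′∈C ne
  Y-spanned {e′} e′∈Y | inj₂ e′∈I+e with insert⁻ e I e′∈I+e
  ...   | inj₁ refl = ⊥-elim (dep (ind-subset M (C⊆Y e′∈Y) ind-Y))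
  ...   | inj₂ e′∈I = λ e′∉I → contradiction e′∈I e′∉I

-- Edge sets of copies of K_{2,3}

Joins : ∀ {n} → Edge n → Fin n → Fin n → Set
Joins ((i , j) , _) x y = (i ≡ x × j ≡ y) ⊎ (i ≡ y × j ≡ x)

joins-sym : ∀ {n} {e : Edge n} {x y} → Joins e x y → Joins e y x
joins-sym = swap

joins-unique : ∀ {n} {e e′ : Edge n} {x y} → Joins e x y → Joins e′ x y → e ≡ e′
joins-unique (inj₁ (refl , refl)) (inj₁ (refl , refl)) = edge-≡ refl
joins-unique (inj₂ (refl , refl)) (inj₂ (refl , refl)) = edge-≡ refl
joins-unique {e = _ , lt} {_ , lt′} (inj₁ (refl , refl)) (inj₂ (refl , refl)) = ⊥-elim (<-asym lt lt′)
joins-unique {e = _ , lt} {_ , lt′} (inj₂ (refl , refl)) (inj₁ (refl , refl)) = ⊥-elim (<-asym lt lt′)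

joins-det : ∀ {n} {e : Edge n} {x y u v} → Joins e x y → Joins e u v →
            (x ≡ u × y ≡ v) ⊎ (x ≡ v × y ≡ u)
joins-det (inj₁ (refl , refl)) (inj₁ (refl , refl)) = inj₁ (refl , refl)
joins-det (inj₁ (refl , refl)) (inj₂ (refl , refl)) = inj₂ (refl , refl)
joins-det (inj₂ (refl , refl)) (inj₁ (refl , refl)) = inj₂ (refl , refl)
joins-det (inj₂ (refl , refl)) (inj₂ (refl , refl)) = inj₁ (refl , refl)

mkEdge : ∀ {n} {x y : Fin n} → x ≢ y → Σ (Edge n) λ e → Joins e x y
mkEdge {x = x} {y} x≢y with <-cmp x y
... | tri< x<y _ _ = ((x , y) , x<y) , inj₁ (refl , refl)
... | tri≈ _ x≡y _ = contradiction x≡y x≢y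
... | tri> _ _ y<x = ((y , x) , y<x) , inj₂ (refl , refl)

left : Fin 2 → Fin 5
left p = p ↑ˡ 3

right : Fin 3 → Fin 5
right q = 2 ↑ʳ q

left≢right : ∀ {p q} → left p ≢ right q
left≢right {zero}     ()
left≢right {suc zero} ()

-- This is literally the test inside `inK23`, so that membership there unfolds to it.
joinsᵇ : ∀ {n} → Edge n → Fin n → Fin n → Bool
joinsᵇ ((i , j) , _) x y = (⌊ i ≟ x ⌋ ∧ ⌊ j ≟ y ⌋) ∨ (⌊ i ≟ y ⌋ ∧ ⌊ j ≟ x ⌋)

joinsᵇ⁺ : ∀ {n} (e : Edge n) {x y} → Joins e x y → T (joinsᵇ e x y)
joinsᵇ⁺ ((i , j) , _) {x} {y} (inj₁ (p , q)) =
  ∨⁺ˡ _ (∧⁺ _ (fromWitness {a? = i ≟ x} p) (fromWitness {a? = j ≟ y} q))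
joinsᵇ⁺ ((i , j) , _) {x} {y} (inj₂ (p , q)) =
  ∨⁺ʳ (⌊ i ≟ x ⌋ ∧ ⌊ j ≟ y ⌋) (∧⁺ _ (fromWitness {a? = i ≟ y} p) (fromWitness {a? = j ≟ x} q))

joinsᵇ⁻ : ∀ {n} (e : Edge n) {x y} → T (joinsᵇ e x y) → Joins e x y
joinsᵇ⁻ ((i , j) , _) {x} {y} t with ∨⁻ (⌊ i ≟ x ⌋ ∧ ⌊ j ≟ y ⌋) t
... | inj₁ t′ with ∧⁻ ⌊ i ≟ x ⌋ t′
...   | p , q = inj₁ (toWitness {a? = i ≟ x} p , toWitness {a? = j ≟ y} q)
joinsᵇ⁻ ((i , j) , _) {x} {y} t | inj₂ t′ with ∧⁻ ⌊ i ≟ y ⌋ t′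
...   | p , q = inj₂ (toWitness {a? = i ≟ y} p , toWitness {a? = j ≟ x} q)

lefts : List (Fin 5)
lefts = map left (allFin 2)

rights : List (Fin 5)
rights = map right (allFin 3)

K23⁺ : ∀ {n} (f : Fin 5 → Fin n) (p : Fin 2) (q : Fin 3) {e : Edge n} →
       Joins e (f (left p)) (f (right q)) → e ∈ inK23 f
K23⁺ f p q {e} e∼ =
  any⁺ (λ x → any (λ y → joinsᵇ e (f x) (f y)) rights)
    (lose (∈-map⁺ left (∈-allFin p))
      (any⁺ (λ y → joinsᵇ e (f (left p)) (f y)) (lose (∈-map⁺ right (∈-allFin q)) (joinsᵇ⁺ e e∼))))

K23⁻ : ∀ {n} (f : Fin 5 → Fin n) {e : Edge n} → e ∈ inK23 f →
       ∃[ p ] ∃[ q ] Joins e (f (left p)) (f (right q))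
K23⁻ f {e} e∈ with find (any⁻ (λ x → any (λ y → joinsᵇ e (f x) (f y)) rights) lefts e∈)
... | x , x∈ , t with find (any⁻ (λ y → joinsᵇ e (f x) (f y)) rights t) | ∈-map⁻ left x∈
...   | y , y∈ , t′ | p , _ , refl with ∈-map⁻ right y∈
...     | q , _ , refl = p , q , joinsᵇ⁻ e t′

-- Matching the ends crosswise would identify a vertex of the two-element side with one of the
-- three-element side.
joins-K23-unique : ∀ {n} {f : Fin 5 → Fin n} → Injective _≡_ _≡_ f → ∀ {p q p′ q′} {e : Edge n} →
                   Joins e (f (left p)) (f (right q)) → Joins e (f (left p′)) (f (right q′)) →
                   p ≡ p′ × q ≡ q′
joins-K23-unique inj {p} {q} {p′} {q′} {e} e∼ e∼′ with joins-det {e = e} e∼ e∼′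
... | inj₁ (eq , eq′) = ↑ˡ-injective 3 p p′ (inj eq) , ↑ʳ-injective 2 q q′ (inj eq′)
... | inj₂ (eq , _)   = contradiction (inj eq) left≢right

card-K23 : ∀ {n} {f : Fin 5 → Fin n} → Injective _≡_ _≡_ f → ∣ inK23 f ∣ ≡ 6
card-K23 {n} {f} inj = ≤-antisym (card≤length (inK23 f) upper) (length≤card (inK23 f) unique lower)
  where
  toEdge : Fin 2 × Fin 3 → Edge n
  toEdge (p , q) = proj₁ (mkEdge (left≢right {p} {q} ∘ inj))

  toEdge-joins : ∀ p q → Joins (toEdge (p , q)) (f (left p)) (f (right q))
  toEdge-joins p q = proj₂ (mkEdge (left≢right {p} {q} ∘ inj))

  edges : List (Edge n)
  edges = map toEdge (cartesianProduct (allFin 2) (allFin 3))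

  upper : ∀ {e} → e ∈ inK23 f → e ∈ˡ edges
  upper {e} e∈ with K23⁻ f {e} e∈
  ... | p , q , e∼ = subst (_∈ˡ edges) (joins-unique (toEdge-joins p q) e∼)
                       (∈-map⁺ toEdge (∈-cartesianProduct⁺ (∈-allFin p) (∈-allFin q)))

  lower : ∀ {e} → e ∈ˡ edges → e ∈ inK23 f
  lower e∈ with ∈-map⁻ toEdge e∈
  ... | (p , q) , _ , refl = K23⁺ f p q {toEdge (p , q)} (toEdge-joins p q)

  toEdge-injective : ∀ {x y} → toEdge x ≡ toEdge y → x ≡ y
  toEdge-injective {p , q} {p′ , q′} eq
    with joins-K23-unique inj {e = toEdge (p , q)} (toEdge-joins p q)
           (subst (λ e → Joins e _ _) (sym eq) (toEdge-joins p′ q′))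
  ... | refl , refl = refl

  unique : Unique edges
  unique = Unique.map⁺ toEdge-injective (Unique.cartesianProduct⁺ (Unique.allFin⁺ 2) (Unique.allFin⁺ 3))

-- The bicircular matroid

Endpoint : ∀ {n} → Fin n → Edge n → Set
Endpoint v ((i , j) , _) = v ≡ i ⊎ v ≡ j

-- An edge set is bicircular-independent iff its edges have a system of distinct endpoints.
record Bicircular {n : ℕ} (X : EdgeSet n) : Set where
  field
    φ           : Edge n → Fin n
    φ-endpoint  : ∀ {e} → e ∈ X → Endpoint (φ e) e
    φ-injective : ∀ {e e′} → e ∈ X → e′ ∈ X → φ e ≡ φ e′ → e ≡ e′

open Bicircular

update : ∀ {n} → (Edge n → Fin n) → Edge n → Fin n → Edge n → Fin n
update φ e v e′ with e′ ≟ᴱ e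
... | yes _ = v
... | no  _ = φ e′

update-same : ∀ {n} (φ : Edge n → Fin n) e v → update φ e v e ≡ v
update-same φ e v with e ≟ᴱ e
... | yes _ = refl
... | no ne = contradiction refl ne

update-other : ∀ {n} (φ : Edge n → Fin n) {e} v {e′} → e′ ≢ e → update φ e v e′ ≡ φ e′
update-other φ {e} v {e′} ne with e′ ≟ᴱ e
... | yes eq = contradiction eq ne
... | no  _  = refl

-- Taking Z = X re-routes an edge of X, taking Z = X + e adds one.
reroute : ∀ {n} {X Z : EdgeSet n} (b : Bicircular X) (e : Edge n) (v : Fin n) → Endpoint v e →
          (∀ {e′} → e′ ∈ X → φ b e′ ≢ v) → (∀ {e′} → e′ ∈ Z → e′ ≡ e ⊎ e′ ∈ X) → Bicircular Z
reroute {X = X} {Z} b e v v-end fresh Z⊆ = record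
  { φ = φ′ ; φ-endpoint = endpoint ; φ-injective = injective }
  where
  φ′ = update (φ b) e v

  old : ∀ {e′} → e′ ∈ Z → e′ ≢ e → e′ ∈ X
  old e′∈ ne with Z⊆ e′∈
  ... | inj₁ eq   = contradiction eq ne
  ... | inj₂ e′∈X = e′∈X

  endpoint : ∀ {e′} → e′ ∈ Z → Endpoint (φ′ e′) e′
  endpoint {e′} e′∈ with e′ ≟ᴱ e
  ... | yes refl = v-end
  ... | no ne    = φ-endpoint b (old e′∈ ne)

  injective : ∀ {x y} → x ∈ Z → y ∈ Z → φ′ x ≡ φ′ y → x ≡ y
  injective {x} {y} x∈ y∈ eq with x ≟ᴱ e | y ≟ᴱ e
  ... | yes refl | yes refl = refl
  ... | yes refl | no  ne   = contradiction (sym eq) (fresh (old y∈ ne))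
  ... | no  ne   | yes refl = contradiction eq (fresh (old x∈ ne))
  ... | no  ne   | no  ne′  = φ-injective b (old x∈ ne) (old y∈ ne′) eq

image : ∀ {n} {X : EdgeSet n} → Bicircular X → List (Fin n)
image {X = X} b = map (φ b) (elems X)

image-unique : ∀ {n} {X : EdgeSet n} (b : Bicircular X) → Unique (image b)
image-unique {X = X} b =
  map-unique (λ x∈ y∈ → φ-injective b (∈-elems⁻ x∈) (∈-elems⁻ y∈)) (elems-unique X)

length-image : ∀ {n} {X : EdgeSet n} (b : Bicircular X) → length (image b) ≡ ∣ X ∣
length-image {X = X} b = trans (length-map (φ b) (elems X)) (sym (card≡length X))

agreement : ∀ {n} {X Y : EdgeSet n} → Bicircular X → Bicircular Y → List (Edge n)
agreement {X = X} b c = filter (λ e → φ b e ≟ φ c e) (elems X)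

-- While |X| < |Y|, some edge e of Y is assigned a vertex v that X does not use. If e ∉ X, it can be added
-- to X; otherwise e is re-routed to v in X, which brings the two assignments closer to each other.
bicircular-augment : ∀ {n} (k : ℕ) {X Y : EdgeSet n} (b : Bicircular X) (c : Bicircular Y) → ∣ X ∣ < ∣ Y ∣ →
                     ∣ X ∣ < k + length (agreement b c) →
                     ∃[ e ] (e ∈ Y × ¬ (e ∈ X) × Bicircular (insert e X))
-- The fuel `k` exceeds the number of edges of `X` on which the assignments still differ; with
-- `k = 0` they would agree on more edges than `X` has.
bicircular-augment zero {X} b c X<Y lt = contradiction
  (≤-trans (length-filter (λ e → φ b e ≟ φ c e) (elems X)) (≤-reflexive (sym (card≡length X)))) (<⇒≱ lt)
bicircular-augment (suc k) {X} {Y} b c X<Y lt with All.all? (_∈ᶠ? image b) (image c)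
... | yes c⊆b = contradiction
  (subst₂ _≤_ (length-image c) (length-image b) (unique⊆⇒length≤ (image-unique c) (All.lookup c⊆b))) (<⇒≱ X<Y)
... | no  c⊈b with find (¬All⇒Any¬ (_∈ᶠ? image b) (image c) c⊈b)
...   | v , v∈c , v∉b with ∈-map⁻ (φ c) v∈c
...     | e , e∈Y , refl with T? (X e)
...       | no  e∉X = e , ∈-elems⁻ e∈Y , e∉X ,
                      reroute b e (φ c e) (φ-endpoint c (∈-elems⁻ e∈Y)) fresh (insert⁻ e X)
  where
  fresh : ∀ {e′} → e′ ∈ X → φ b e′ ≢ φ c e
  fresh e′∈ eq = v∉b (subst (_∈ˡ image b) eq (∈-map⁺ (φ b) (∈-elems⁺ e′∈)))
...       | yes e∈X = bicircular-augment k b′ c X<Y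
                        (≤-trans lt (≤-trans (≤-reflexive (sym (+-suc k _))) (+-monoʳ-≤ k closer)))
  where
  fresh : ∀ {e′} → e′ ∈ X → φ b e′ ≢ φ c e
  fresh e′∈ eq = v∉b (subst (_∈ˡ image b) eq (∈-map⁺ (φ b) (∈-elems⁺ e′∈)))

  b′ : Bicircular X
  b′ = reroute b e (φ c e) (φ-endpoint c (∈-elems⁻ e∈Y)) fresh inj₂

  -- Before the change the assignments differed at `e`, since `b` did not use `φ c e`. All earlier
  -- agreements lie at other edges and persist.
  closer : suc (length (agreement b c)) ≤ length (agreement b′ c)
  closer = unique⊆⇒length≤
    (¬Any⇒All¬ _ (fresh e∈X ∘ proj₂ ∘ ∈-filter⁻ (λ e → φ b e ≟ φ c e) {xs = elems X})
      ∷ Unique.filter⁺ (λ e → φ b e ≟ φ c e) (elems-unique X))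
    λ { (here refl) → ∈-filter⁺ (λ e → φ b′ e ≟ φ c e) (∈-elems⁺ e∈X) (update-same (φ b) e (φ c e))
      ; (there x∈)  → keep x∈ }
    where
    keep : ∀ {x} → x ∈ˡ agreement b c → x ∈ˡ agreement b′ c
    keep {x} x∈ with ∈-filter⁻ (λ e → φ b e ≟ φ c e) {xs = elems X} x∈
    ... | x∈X , eq = ∈-filter⁺ (λ e → φ b′ e ≟ φ c e) x∈X
                       (trans (update-other (φ b) (φ c e) λ { refl → fresh e∈X eq }) eq)

bicircular : ∀ n → Fin n → Matroid n
bicircular n v₀ = record
  { Ind = Bicircular
  -- Assignments are total functions, so even the empty set requires some vertex as a value.
  ; ind-empty = record { φ = λ _ → v₀ ; φ-endpoint = λ () ; φ-injective = λ () }
  ; ind-subset = λ X⊆Y b → record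
      { φ = φ b ; φ-endpoint = φ-endpoint b ∘ X⊆Y _
      ; φ-injective = λ p q → φ-injective b (X⊆Y _ p) (X⊆Y _ q) }
  ; ind-augment = λ {X} b c X<Y → bicircular-augment (suc ∣ X ∣) b c X<Y (s≤s (m≤m+n _ _))
  }

-- For the edge (p₀, q₀) of K_{2,3}, orients the 4-cycle avoiding q₀ cyclically and sends the other
-- edge at q₀ to q₀; this gives distinct endpoints to all edges but (p₀, q₀).
orient : Fin 2 → Fin 3 → Fin 2 → Fin 3 → Fin 5
orient p₀ q₀ p q =
  if not ⌊ q ≟ q₀ ⌋ ∧ (⌊ toℕ q ℕ.≟ suc (toℕ q₀) % 3 ⌋ xor ⌊ p ≟ p₀ ⌋) then left p else right q

orient-end : ∀ p₀ q₀ p q → orient p₀ q₀ p q ≡ left p ⊎ orient p₀ q₀ p q ≡ right q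
orient-end p₀ q₀ p q with not ⌊ q ≟ q₀ ⌋ ∧ (⌊ toℕ q ℕ.≟ suc (toℕ q₀) % 3 ⌋ xor ⌊ p ≟ p₀ ⌋)
... | true  = inj₁ refl
... | false = inj₂ refl

abstract
  -- Settled by evaluating all 216 choices of the six indices.
  orient-injective : ∀ p₀ q₀ p q p′ q′ → ¬ (p ≡ p₀ × q ≡ q₀) → ¬ (p′ ≡ p₀ × q′ ≡ q₀) →
                     orient p₀ q₀ p q ≡ orient p₀ q₀ p′ q′ → p ≡ p′ × q ≡ q′
  orient-injective = from-yes
    (all? λ p₀ → all? λ q₀ → all? λ p → all? λ q → all? λ p′ → all? λ q′ →
      ¬? (p ≟ p₀ ×-dec q ≟ q₀) →-dec ¬? (p′ ≟ p₀ ×-dec q′ ≟ q₀) →-dec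
      orient p₀ q₀ p q ≟ orient p₀ q₀ p′ q′ →-dec (p ≟ p′ ×-dec q ≟ q′))

endpoint-joins : ∀ {n} {e : Edge n} {v x y} → Endpoint v e → Joins e x y → v ≡ x ⊎ v ≡ y
endpoint-joins (inj₁ refl) (inj₁ (refl , refl)) = inj₁ refl
endpoint-joins (inj₁ refl) (inj₂ (refl , refl)) = inj₂ refl
endpoint-joins (inj₂ refl) (inj₁ (refl , refl)) = inj₂ refl
endpoint-joins (inj₂ refl) (inj₂ (refl , refl)) = inj₁ refl

joins-endpoint : ∀ {n} {e : Edge n} {v x y} → Joins e x y → v ≡ x ⊎ v ≡ y → Endpoint v e
joins-endpoint (inj₁ (refl , refl)) v∈ = v∈
joins-endpoint (inj₂ (refl , refl)) v∈ = swap v∈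

-- Six edges cannot have distinct endpoints among five vertices. A proper subset misses some edge,
-- and `orient` relative to that edge supplies distinct endpoints for the others.
bicircular-isK23 : ∀ n (v₀ : Fin n) → IsK23Matroid (bicircular n v₀)
bicircular-isK23 n v₀ f inj = dependent , proper
  where
  dependent : ¬ Bicircular (inK23 f)
  dependent b = contradiction
    (subst (_≤ 5) (trans (length-image b) (card-K23 inj)) (unique⊆⇒length≤ (image-unique b) image⊆))
    (<⇒≱ ≤-refl)
    where
    image⊆ : ∀ {v} → v ∈ˡ image b → v ∈ˡ map f (allFin 5)
    image⊆ v∈ with ∈-map⁻ (φ b) v∈
    ... | e , e∈ , refl with K23⁻ f {e} (∈-elems⁻ {X = inK23 f} e∈)
    ...   | p , q , e∼ with endpoint-joins {e = e} (φ-endpoint b (∈-elems⁻ {X = inK23 f} e∈)) e∼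
    ...     | inj₁ eq = subst (_∈ˡ _) (sym eq) (∈-map⁺ f (∈-allFin (left p)))
    ...     | inj₂ eq = subst (_∈ˡ _) (sym eq) (∈-map⁺ f (∈-allFin (right q)))

  proper : ∀ X → X ⊆ inK23 f → ∃[ e ] (e ∈ inK23 f × ¬ (e ∈ X)) → Bicircular X
  proper X X⊆K (e₀ , e₀∈K , e₀∉X) with K23⁻ f {e₀} e₀∈K
  ... | p₀ , q₀ , e₀∼ = record { φ = ψ ; φ-endpoint = endpoint ; φ-injective = injective }
    where
    ψ : Edge n → Fin n
    ψ e with T? (inK23 f e)
    ... | yes e∈K = let p , q , _ = K23⁻ f {e} e∈K in f (orient p₀ q₀ p q)
    -- An arbitrary value: all edges of `X` lie in the copy.
    ... | no  _   = v₀

    spec : ∀ {e} → e ∈ X → ∃[ p ] ∃[ q ] (Joins e (f (left p)) (f (right q)) ×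
                                         ¬ (p ≡ p₀ × q ≡ q₀) × ψ e ≡ f (orient p₀ q₀ p q))
    spec {e} e∈X with T? (inK23 f e)
    ... | no  e∉K = contradiction (X⊆K e e∈X) e∉K
    ... | yes e∈K with K23⁻ f {e} e∈K
    ...   | p , q , e∼ =
      p , q , e∼ , (λ { (refl , refl) → e₀∉X (subst (_∈ X) (joins-unique e∼ e₀∼) e∈X) }) , refl

    endpoint : ∀ {e} → e ∈ X → Endpoint (ψ e) e
    endpoint {e} e∈X with spec e∈X
    ... | p , q , e∼ , _ , eq with orient-end p₀ q₀ p q
    ...   | inj₁ l = joins-endpoint {e = e} e∼ (inj₁ (trans eq (cong f l)))
    ...   | inj₂ r = joins-endpoint {e = e} e∼ (inj₂ (trans eq (cong f r)))

    injective : ∀ {e e′} → e ∈ X → e′ ∈ X → ψ e ≡ ψ e′ → e ≡ e′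
    injective e∈X e′∈X ψ≡ with spec e∈X | spec e′∈X
    ... | p , q , e∼ , ne , eq | p′ , q′ , e′∼ , ne′ , eq′
      with orient-injective p₀ q₀ p q p′ q′ ne ne′ (inj (trans (sym eq) (trans ψ≡ eq′)))
    ...   | refl , refl = joins-unique e∼ e′∼

-- A spanning star together with one more edge: a unicyclic graph.
star⁺ : ∀ {m} → EdgeSet (7 + m)
star⁺ ((zero , _)     , _) = true
star⁺ ((suc i , j) , _) = ⌊ i ≟ zero ⌋ ∧ ⌊ j ≟ suc (suc zero) ⌋

-- The triangle on 0, 1, 2 is oriented cyclically: 01 gets 0, 12 gets 1 and 02 gets 2. Every other
-- star edge gets its leaf.
star⁺-bicircular : ∀ {m} → Bicircular (star⁺ {m})
star⁺-bicircular {m} = record { φ = ψ ; φ-endpoint = λ {e} → endpoint {e} ; φ-injective = injective }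
  where
  ψ : Edge (7 + m) → Fin (7 + m)
  ψ ((zero , zero)        , _) = zero
  ψ ((zero , suc zero)    , _) = zero
  ψ ((zero , suc (suc j)) , _) = suc (suc j)
  ψ ((suc i , _)          , _) = suc i

  endpoint : ∀ {e} → e ∈ star⁺ → Endpoint (ψ e) e
  endpoint {(zero , zero)        , _} _ = inj₁ refl
  endpoint {(zero , suc zero)    , _} _ = inj₁ refl
  endpoint {(zero , suc (suc j)) , _} _ = inj₂ refl
  endpoint {(suc i , _)          , _} _ = inj₁ refl

  extra : ∀ {i j lt} → ((suc i , j) , lt) ∈ star⁺ → i ≡ zero × j ≡ suc (suc zero)
  extra {i} {j} t with ∧⁻ ⌊ i ≟ zero ⌋ t
  ... | p , q = toWitness {a? = i ≟ zero} p , toWitness {a? = j ≟ suc (suc zero)} q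

  injective : ∀ {e e′} → e ∈ star⁺ → e′ ∈ star⁺ → ψ e ≡ ψ e′ → e ≡ e′
  injective {(zero , suc zero) , _}    {(zero , suc zero) , _}    _ _ _    = edge-≡ refl
  injective {(zero , suc (suc j)) , _} {(zero , suc (suc .j)) , _} _ _ refl = edge-≡ refl
  injective {(zero , suc (suc j)) , _} {(suc i , k) , lt} _ t refl with extra {lt = lt} t
  ... | () , _
  injective {(suc i , k) , lt} {(zero , suc (suc j)) , _} t _ refl with extra {lt = lt} t
  ... | () , _
  injective {(suc i , j) , lt} {(suc i′ , j′) , lt′} t t′ _
    with extra {lt = lt} t | extra {lt = lt′} t′
  ... | refl , refl | refl , refl = edge-≡ refl

-- The witnesses are the extra edge 12 and the star edges to the leaves 1 to 6. Seven edges are one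
-- more than the rank of the sparse paving matroid.
card-star⁺ : ∀ {m} → 7 ≤ ∣ star⁺ {m} ∣
card-star⁺ {m} = length≤card star⁺ (Unique.tabulate⁺ edge-injective) ∈-star
  where
  edge : Fin 7 → Edge (7 + m)
  edge zero    = (suc zero , suc (suc zero)) , s≤s (s≤s z≤n)
  edge (suc i) = (zero , suc (i ↑ˡ m)) , s≤s z≤n

  edge-injective : ∀ {i j} → edge i ≡ edge j → i ≡ j
  edge-injective {zero}  {zero}  _  = refl
  edge-injective {suc i} {suc j} eq =
    cong suc (↑ˡ-injective m i j (suc-injective (cong (proj₂ ∘ proj₁) eq)))

  ∈-star : ∀ {e} → e ∈ˡ tabulate edge → e ∈ star⁺
  ∈-star e∈ with ∈-tabulate⁻ {f = edge} e∈
  ... | zero  , refl = _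
  ... | suc i , refl = _

-- The sparse paving matroid of rank 6 whose circuit-hyperplanes are the copies of K_{2,3}

ContainsK23 : ∀ {n} → EdgeSet n → Set
ContainsK23 {n} X = Σ (Fin 5 → Fin n) λ f → Injective _≡_ _≡_ f × inK23 f ⊆ X

containsK23⇒card : ∀ {n} {X : EdgeSet n} → ContainsK23 X → 6 ≤ ∣ X ∣
containsK23⇒card {X = X} (f , inj , K⊆X) = subst (_≤ ∣ X ∣) (card-K23 inj) (card-mono (inK23 f) X K⊆X)

K23-⊇ : ∀ {n} {X : EdgeSet n} {f} → Injective _≡_ _≡_ f → inK23 f ⊆ X → ∣ X ∣ ≤ 6 → X ⊆ inK23 f
K23-⊇ {X = X} {f} inj K⊆X X≤6 = ⊆-card≤⇒⊇ (inK23 f) X K⊆X (subst (∣ X ∣ ≤_) (sym (card-K23 inj)) X≤6)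

Left Right : ∀ {n} → (Fin 5 → Fin n) → Fin n → Set
Left  f x = ∃[ p ] x ≡ f (left p)
Right f x = ∃[ q ] x ≡ f (right q)

left-right-disjoint : ∀ {n} {f : Fin 5 → Fin n} → Injective _≡_ _≡_ f → ∀ {x} → Left f x → ¬ Right f x
left-right-disjoint inj (_ , refl) (_ , eq) = left≢right (inj eq)

abstract
  K23-sides : ∀ {n} (f : Fin 5 → Fin n) {e : Edge n} {x y} → e ∈ inK23 f → Joins e x y →
              (Left f x × Right f y) ⊎ (Right f x × Left f y)
  K23-sides f {e} e∈ e∼ with K23⁻ f {e} e∈
  ... | p , q , e∼′ with joins-det {e = e} e∼ e∼′
  ...   | inj₁ (x≡ , y≡) = inj₁ ((p , x≡) , (q , y≡))
  ...   | inj₂ (x≡ , y≡) = inj₂ ((q , x≡) , (p , y≡))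

sides-K23 : ∀ {n} (f : Fin 5 → Fin n) {e : Edge n} {x y} → Left f x → Right f y → Joins e x y → e ∈ inK23 f
sides-K23 f {e} (p , refl) (q , refl) e∼ = K23⁺ f p q {e} e∼

-- The graph is bipartite: two consecutive edges put `x` and `z` on the same side.
K23-triangle-free : ∀ {n} {f : Fin 5 → Fin n} → Injective _≡_ _≡_ f → ∀ {e₁ e₂ e₃ : Edge n} {x y z} →
                    Joins e₁ x y → Joins e₂ y z → Joins e₃ x z →
                    e₁ ∈ inK23 f → e₂ ∈ inK23 f → ¬ (e₃ ∈ inK23 f)
K23-triangle-free {f = f} inj {e₁} {e₂} {e₃} j₁ j₂ j₃ e₁∈ e₂∈ e₃∈
  with K23-sides f {e₁} e₁∈ j₁ | K23-sides f {e₂} e₂∈ j₂ | K23-sides f {e₃} e₃∈ j₃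
... | inj₁ (_ , ry) | inj₁ (ly , _) | _ = left-right-disjoint inj ly ry
... | inj₂ (_ , ly) | inj₂ (ry , _) | _ = left-right-disjoint inj ly ry
... | inj₁ (lx , _) | inj₂ (_ , lz) | inj₁ (_ , rz) = left-right-disjoint inj lz rz
... | inj₁ (lx , _) | inj₂ (_ , lz) | inj₂ (rx , _) = left-right-disjoint inj lx rx
... | inj₂ (rx , _) | inj₁ (_ , rz) | inj₁ (lx , _) = left-right-disjoint inj lx rx
... | inj₂ (rx , _) | inj₁ (_ , rz) | inj₂ (_ , lz) = left-right-disjoint inj lz rz

no-three-lefts : ∀ {n} (f : Fin 5 → Fin n) {g : Fin 3 → Fin n} → Injective _≡_ _≡_ g → ¬ (∀ q → Left f (g q))
no-three-lefts f {g} inj lefts′ with pigeonhole (≤-refl {3}) (proj₁ ∘ lefts′)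
... | q , q′ , q<q′ , eq = contradiction
  (inj (trans (proj₂ (lefts′ q)) (trans (cong (f ∘ left) eq) (sym (proj₂ (lefts′ q′))))))
  (λ { refl → <-irrefl refl q<q′ })

other : Fin 2 → Fin 2
other zero       = suc zero
other (suc zero) = zero

other≢ : ∀ {p} → other p ≢ p
other≢ {zero} ()
other≢ {suc zero} ()

∃≢ : (q : Fin 3) → ∃[ b ] b ≢ q
∃≢ zero    = suc zero , λ ()
∃≢ (suc _) = zero , λ ()

-- The three edges at the vertex opposite to e on its side of the bipartition force that vertex to be
-- on the two-element side of any other copy of K_{2,3} that contains them.
K23-completion : ∀ {n} {f g : Fin 5 → Fin n} → Injective _≡_ _≡_ f → Injective _≡_ _≡_ g →
                 ∀ {e : Edge n} → e ∈ inK23 f → (inK23 f ─ e) ⊆ inK23 g → e ∈ inK23 g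
K23-completion {n} {f} {g} f-inj g-inj {e} e∈f f⊆g with K23⁻ f {e} e∈f
... | p , q , e∼ = goal
  where
  p′ : Fin 2
  p′ = other p

  edge : (a : Fin 2) (b : Fin 3) → Σ (Edge n) λ e′ → Joins e′ (f (left a)) (f (right b))
  edge a b = mkEdge (left≢right {a} {b} ∘ f-inj)

  sides : ∀ a b → ¬ (a ≡ p × b ≡ q) →
          (Left g (f (left a)) × Right g (f (right b))) ⊎ (Right g (f (left a)) × Left g (f (right b)))
  sides a b ne = K23-sides g {e′}
    (f⊆g e′ (─⁺ (inK23 f) e {e′} (K23⁺ f a b {e′} e′∼)
      λ eq → ne (joins-K23-unique f-inj {e = e} (subst (λ e → Joins e _ _) eq e′∼) e∼))) e′∼
    where
    e′ = proj₁ (edge a b)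
    e′∼ = proj₂ (edge a b)

  p′-left : Left g (f (left p′))
  p′-left with sides p′ zero (other≢ ∘ proj₁)
  ... | inj₁ (l , _) = l
  -- On the right of `g`, this vertex would force its three neighbours in `f` to the left of `g`,
  -- where there are only two places.
  ... | inj₂ (r , _) = ⊥-elim (no-three-lefts g (↑ʳ-injective 2 _ _ ∘ f-inj) all-left)
    where
    all-left : ∀ b → Left g (f (right b))
    all-left b with sides p′ b (other≢ ∘ proj₁)
    ... | inj₁ (l , _)  = ⊥-elim (left-right-disjoint g-inj l r)
    ... | inj₂ (_ , l) = l

  right-right : ∀ b → Right g (f (right b))
  right-right b with sides p′ b (other≢ ∘ proj₁)
  ... | inj₁ (_ , r) = r
  ... | inj₂ (r , _) = ⊥-elim (left-right-disjoint g-inj p′-left r)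

  p-left : Left g (f (left p))
  p-left with ∃≢ q
  -- The three-element side has a second vertex, so some edge at `f (left p)` survives the removal
  -- of `e`.
  ... | b , b≢q with sides p b (b≢q ∘ proj₂)
  ...   | inj₁ (l , _) = l
  ...   | inj₂ (_ , l) = ⊥-elim (left-right-disjoint g-inj l (right-right b))

  goal : e ∈ inK23 g
  goal = sides-K23 g {e} p-left (right-right q) e∼

injective? : ∀ {n} (f : Fin 5 → Fin n) → Dec (Injective _≡_ _≡_ f)
injective? f = map′ (λ h {x} {y} → h x y) (λ h x y → h)
                    (all? λ x → all? λ y → f x ≟ f y →-dec x ≟ y)

quintuple : ∀ {n} → Fin n × Fin n × Fin n × Fin n × Fin n → Fin 5 → Fin n
quintuple (a , b , c , d , e) = lookup (a ∷ b ∷ c ∷ d ∷ e ∷ [])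

quintuples : ∀ n → List (Fin 5 → Fin n)
quintuples n = map quintuple
  (cartesianProduct vs (cartesianProduct vs (cartesianProduct vs (cartesianProduct vs vs))))
  where
  vs = allFin n

K23s : ∀ n → List (EdgeSet n)
K23s n = map inK23 (filter injective? (quintuples n))

∈-K23s⁺ : ∀ {n} {f : Fin 5 → Fin n} → Injective _≡_ _≡_ f → inK23 f ∈ˡ K23s n
-- `inK23` evaluates its argument only at the five numerals, where `f′` computes to the values of
-- `f`; hence `inK23 f′` and `inK23 f` are equal by computation.
∈-K23s⁺ {n} {f} inj = ∈-map⁺ inK23 (∈-filter⁺ injective? {x = f′}
  (∈-map⁺ quintuple (∈-cartesianProduct⁺ (at 0F) (∈-cartesianProduct⁺ (at 1F)
    (∈-cartesianProduct⁺ (at 2F) (∈-cartesianProduct⁺ (at 3F) (at 4F))))))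
  λ {x} {y} eq → inj (trans (sym (agree x)) (trans eq (agree y))))
  where
  f′ : Fin 5 → Fin n
  f′ = quintuple (f 0F , f 1F , f 2F , f 3F , f 4F)

  at : ∀ i → f i ∈ˡ allFin n
  at i = ∈-allFin (f i)

  agree : ∀ i → f′ i ≡ f i
  agree 0F = refl
  agree 1F = refl
  agree 2F = refl
  agree 3F = refl
  agree 4F = refl

abstract
  ∈-K23s⁻ : ∀ {n} {C} → C ∈ˡ K23s n → Σ (Fin 5 → Fin n) λ f → Injective _≡_ _≡_ f × C ≡ inK23 f
  ∈-K23s⁻ C∈ with ∈-map⁻ inK23 C∈
  ... | f , f∈ , eq = f , (λ {x} {y} → proj₂ (∈-filter⁻ injective? {xs = quintuples _} f∈) {x} {y}) , eq

  containsK23? : ∀ {n} (X : EdgeSet n) → Dec (ContainsK23 X)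
  containsK23? {n} X = map′ to from (Any.any? (_⊆? X) (K23s n))
    where
    to : Any (_⊆ X) (K23s n) → ContainsK23 X
    to some with find some
    ... | C , C∈ , C⊆X with ∈-K23s⁻ C∈
    ...   | f , inj , refl = f , inj , C⊆X

    from : ContainsK23 X → Any (_⊆ X) (K23s n)
    from (f , inj , K⊆X) = lose (∈-K23s⁺ inj) K⊆X

Paving : ∀ {n} → EdgeSet n → Set
Paving X = ∣ X ∣ ≤ 6 × ¬ ContainsK23 X

-- This is the sparse paving condition. By cardinality the two copies are exactly `X + e` and
-- `X + e′`, so the first without `e` lies in the second. By `K23-completion` the second contains
-- `e` as well.
K23-extension-unique : ∀ {n} {X : EdgeSet n} {e e′ : Edge n} → ∣ X ∣ ≤ 5 → ¬ (e ∈ X) → ¬ (e′ ∈ X) →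
                       ContainsK23 (insert e X) → ContainsK23 (insert e′ X) → e ≡ e′
K23-extension-unique {X = X} {e} {e′} X≤5 e∉X e′∉X (f , f-inj , f⊆) (g , g-inj , g⊆) =
  result (insert⁻ e′ X (g⊆ e (K23-completion f-inj g-inj {e} e∈f f─e⊆g)))
  where
  ≤6 : ∀ {x} → ¬ (x ∈ X) → ∣ insert x X ∣ ≤ 6
  ≤6 {x} x∉X = subst (_≤ 6) (sym (card-insert x X x∉X)) (s≤s X≤5)

  e∈f : e ∈ inK23 f
  e∈f = K23-⊇ f-inj f⊆ (≤6 e∉X) e (insert⁺ˡ e X)

  f─e⊆g : (inK23 f ─ e) ⊆ inK23 g
  f─e⊆g x x∈ with ─⁻ (inK23 f) e {x} x∈
  ... | x∈f , x≢e with insert⁻ e X (f⊆ x x∈f)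
  ...   | inj₁ x≡e = contradiction x≡e x≢e
  ...   | inj₂ x∈X = K23-⊇ g-inj g⊆ (≤6 e′∉X) x (insert⁺ʳ e′ X x x∈X)

  result : e ≡ e′ ⊎ e ∈ X → e ≡ e′
  result (inj₁ eq)  = eq
  result (inj₂ e∈X) = contradiction e∈X e∉X

-- Try any `e` of `Y` outside `X`. If it completes a copy of K_{2,3}, then `Y` is not `X + e`, so
-- `Y` offers another edge `e′`; by `K23-extension-unique` at most one edge can complete a copy.
paving-augment : ∀ {n} {X Y : EdgeSet n} → Paving X → Paving Y → ∣ X ∣ < ∣ Y ∣ →
                 ∃[ e ] (e ∈ Y × ¬ (e ∈ X) × Paving (insert e X))
paving-augment {X = X} {Y} (X≤6 , X-free) (Y≤6 , Y-free) X<Y with card<⇒∃ X Y X<Y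
... | e , e∈Y , e∉X with containsK23? (insert e X)
...   | no  free = e , e∈Y , e∉X , subst (_≤ 6) (sym (card-insert e X e∉X)) (≤-trans X<Y Y≤6) , free
...   | yes (f , inj , K⊆) with ⊆-or-∃∉ Y (insert e X)
...     | inj₁ Y⊆ = ⊥-elim (Y-free (f , inj , λ x x∈ → ⊇ x (K⊆ x x∈)))
  where
  ⊇ : insert e X ⊆ Y
  ⊇ = ⊆-card≤⇒⊇ Y (insert e X) Y⊆ (subst (_≤ ∣ Y ∣) (sym (card-insert e X e∉X)) X<Y)
...     | inj₂ (e′ , e′∈Y , e′∉) =
  e′ , e′∈Y , e′∉X , subst (_≤ 6) (sym (card-insert e′ X e′∉X)) (≤-trans X<Y Y≤6) ,
  λ K → e′∉ (subst (_∈ insert e X)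
              (K23-extension-unique (≤-pred (≤-trans X<Y Y≤6)) e∉X e′∉X (f , inj , K⊆) K) (insert⁺ˡ e X))
  where
  e′∉X : ¬ (e′ ∈ X)
  e′∉X = e′∉ ∘ insert⁺ʳ e X e′

paving : ∀ n → Matroid n
paving n = record
  { Ind = Paving
  ; ind-empty = subst (_≤ 6) (sym card-∅) z≤n , λ K → contradiction (subst (6 ≤_) card-∅ (containsK23⇒card K)) λ ()
  ; ind-subset = λ {X} {Y} X⊆Y (Y≤6 , free) → ≤-trans (card-mono X Y X⊆Y) Y≤6 ,
                   λ (f , inj , K⊆X) → free (f , inj , λ e e∈ → X⊆Y e (K⊆X e e∈))
  ; ind-augment = paving-augment
  }
  where
  card-∅ : ∣ ∅ {n} ∣ ≡ 0
  card-∅ = n≤0⇒n≡0 (card≤length (∅ {n}) {[]} λ ())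

paving-isK23 : ∀ n → IsK23Matroid (paving n)
paving-isK23 n f inj = (λ (_ , free) → free (f , inj , λ _ → id)) , proper
  where
  proper : ∀ X → X ⊆ inK23 f → ∃[ e ] (e ∈ inK23 f × ¬ (e ∈ X)) → Paving X
  proper X X⊆K (e , e∈K , e∉X) = ≤-trans (n≤1+n _) X<6 , λ K → <⇒≱ X<6 (containsK23⇒card K)
    where
    X<6 : ∣ X ∣ < 6
    X<6 = subst₂ _≤_ (card-insert e X e∉X) (card-K23 inj)
            (card-mono (insert e X) (inK23 f) (insert-⊆ e X (inK23 f) e∈K X⊆K))

-- A copy of K_{2,3} inside so small a set would be the whole set and thus contain the triangle.
paving-of-triangle : ∀ {n} {X : EdgeSet n} {e₁ e₂ e₃ : Edge n} {x y z} → ∣ X ∣ ≤ 6 →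
                     Joins e₁ x y → Joins e₂ y z → Joins e₃ x z → e₁ ∈ X → e₂ ∈ X → e₃ ∈ X → Paving X
paving-of-triangle {e₁ = e₁} {e₂} {e₃} X≤6 j₁ j₂ j₃ e₁∈ e₂∈ e₃∈ = X≤6 , λ (f , inj , K⊆X) →
  K23-triangle-free inj {e₁} {e₂} {e₃} j₁ j₂ j₃ (K23-⊇ inj K⊆X X≤6 e₁ e₁∈) (K23-⊇ inj K⊆X X≤6 e₂ e₂∈)
                                                 (K23-⊇ inj K⊆X X≤6 e₃ e₃∈)

-- Maximality of the sparse paving matroid

∈-⟦⟧⁺ : ∀ {n} {l : List (Edge n)} {e} → e ∈ˡ l → e ∈ ⟦ l ⟧
∈-⟦⟧⁺ {l = l} {e} = fromWitness {a? = e ∈? l}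

∈-⟦⟧⁻ : ∀ {n} {l : List (Edge n)} {e} → e ∈ ⟦ l ⟧ → e ∈ˡ l
∈-⟦⟧⁻ {l = l} {e} = toWitness {a? = e ∈? l}

SpannedPair : ∀ {n} → Matroid n → EdgeSet n → Fin n → Fin n → Set
SpannedPair M I x y = ∀ {e} → Joins e x y → Spanned M I e

spanned-swap : ∀ {n} (M : Matroid n) (I : EdgeSet n) {x y} → SpannedPair M I x y → SpannedPair M I y x
spanned-swap M I sp {e} e∼ = sp (joins-sym {e = e} e∼)

∈⇒spanned : ∀ {n} (M : Matroid n) {I : EdgeSet n} {e x y} → e ∈ I → Joins e x y → SpannedPair M I x y
∈⇒spanned M {I} e∈I e∼ e′∼ e′∉I = contradiction (subst (_∈ I) (joins-unique e∼ e′∼) e∈I) e′∉I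

-- The inference rule for all closure computations below: five spanned edges of a copy span the
-- sixth. As `f` may be relabelled, the sixth can be any edge of the copy.
K23-spans : ∀ {n} (M : Matroid n) (I : EdgeSet n) → IsK23Matroid M → Ind M I →
            {f : Fin 5 → Fin n} → Injective _≡_ _≡_ f →
            SpannedPair M I (f 0F) (f 3F) → SpannedPair M I (f 0F) (f 4F) →
            SpannedPair M I (f 1F) (f 2F) → SpannedPair M I (f 1F) (f 3F) → SpannedPair M I (f 1F) (f 4F) →
            SpannedPair M I (f 0F) (f 2F)
K23-spans M I isK ind-I {f} inj s03 s04 s12 s13 s14 {e} e∼ =
  circuit-spans M ind-I (isK f inj) (K23⁺ f 0F 0F {e} e∼) others
  where
  others : ∀ {e′} → e′ ∈ inK23 f → e′ ≢ e → Spanned M I e′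
  others {e′} e′∈ ne with K23⁻ f {e′} e′∈
  ... | 0F , 0F , e′∼ = contradiction (joins-unique e′∼ e∼) ne
  ... | 0F , 1F , e′∼ = s03 e′∼
  ... | 0F , 2F , e′∼ = s04 e′∼
  ... | 1F , 0F , e′∼ = s12 e′∼
  ... | 1F , 1F , e′∼ = s13 e′∼
  ... | 1F , 2F , e′∼ = s14 e′∼

module AbovePaving {n : ℕ} (M : Matroid n) (isK : IsK23Matroid M) (paving⪯M : paving n ⪯ M) where

  -- In a K₅ on {0,1,2,3,4} the independent set J spans in turn 14, 34, 01 and 23.
  module _ (g : Fin 5 → Fin n) (g-inj : Injective _≡_ _≡_ g) where

    private
      edge : ∀ p q → p ≢ q → Σ (Edge n) λ e → Joins e (g p) (g q)
      edge p q ne = mkEdge (ne ∘ g-inj)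

      e02 = edge 0F 2F λ ()
      e03 = edge 0F 3F λ ()
      e04 = edge 0F 4F λ ()
      e12 = edge 1F 2F λ ()
      e13 = edge 1F 3F λ ()
      e24 = edge 2F 4F λ ()

      -- This is the K_{2,3} with parts {0,1} and {2,3,4} in which 14 is replaced by 24. The
      -- triangle 024 makes it independent, while 14 is spanned at once.
      l : List (Edge n)
      l = proj₁ e02 ∷ proj₁ e04 ∷ proj₁ e24 ∷ proj₁ e03 ∷ proj₁ e12 ∷ proj₁ e13 ∷ []

    J : EdgeSet n
    J = ⟦ l ⟧

    card-J : ∣ J ∣ ≤ 6
    card-J = card≤length J {l} ∈-⟦⟧⁻

    ind-J : Ind M J
    ind-J = paving⪯M J (paving-of-triangle card-J (proj₂ e02) (proj₂ e24) (proj₂ e04)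
      (∈-⟦⟧⁺ {l = l} (here refl)) (∈-⟦⟧⁺ {l = l} (there (there (here refl)))) (∈-⟦⟧⁺ {l = l} (there (here refl))))

    private
      Sp : Fin 5 → Fin 5 → Set
      Sp p q = SpannedPair M J (g p) (g q)

      rev : ∀ {p q} → Sp p q → Sp q p
      rev = spanned-swap M J

      given : ∀ {p q} (e : Σ (Edge n) λ e → Joins e (g p) (g q)) → proj₁ e ∈ˡ l → Sp p q
      given (_ , e∼) e∈ = ∈⇒spanned M (∈-⟦⟧⁺ {l = l} e∈) e∼

      -- Applies the copy with parts {x,y} and {u,v,w} to obtain the edge xu; the implicit argument
      -- checks by evaluation that the labels are distinct.
      step : ∀ x y u v w {_ : True (injective? (quintuple (x , y , u , v , w)))} →
             Sp x v → Sp x w → Sp y u → Sp y v → Sp y w → Sp x u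
      step x y u v w {t} = K23-spans M J isK ind-J {f = g ∘ quintuple (x , y , u , v , w)} (toWitness t ∘ g-inj)

      s02 = given e02 (here refl)
      s04 = given e04 (there (here refl))
      s24 = given e24 (there (there (here refl)))
      s03 = given e03 (there (there (there (here refl))))
      s12 = given e12 (there (there (there (there (here refl)))))
      s13 = given e13 (there (there (there (there (there (here refl))))))
      s14 = step 1F 0F 4F 2F 3F s12 s13 s04 s02 s03
      s34 = step 3F 2F 4F 0F 1F (rev s03) (rev s13) s24 (rev s02) (rev s12)
      s01 = step 0F 4F 1F 2F 3F s02 s03 (rev s14) (rev s24) (rev s34)
      s23 = step 2F 4F 3F 0F 1F (rev s02) (rev s12) (rev s34) (rev s04) (rev s14)

    J-spans : ∀ p q → p ≢ q → Sp p q
    J-spans 0F 0F ne = contradiction refl ne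
    J-spans 0F 1F _ = s01
    J-spans 0F 2F _ = s02
    J-spans 0F 3F _ = s03
    J-spans 0F 4F _ = s04
    J-spans 1F 0F _ = rev s01
    J-spans 1F 1F ne = contradiction refl ne
    J-spans 1F 2F _ = s12
    J-spans 1F 3F _ = s13
    J-spans 1F 4F _ = s14
    J-spans 2F 0F _ = rev s02
    J-spans 2F 1F _ = rev s12
    J-spans 2F 2F ne = contradiction refl ne
    J-spans 2F 3F _ = s23
    J-spans 2F 4F _ = s24
    J-spans 3F 0F _ = rev s03
    J-spans 3F 1F _ = rev s13
    J-spans 3F 2F _ = rev s23
    J-spans 3F 3F ne = contradiction refl ne
    J-spans 3F 4F _ = s34
    J-spans 4F 0F _ = rev s04
    J-spans 4F 1F _ = rev s14
    J-spans 4F 2F _ = rev s24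
    J-spans 4F 3F _ = rev s34
    J-spans 4F 4F ne = contradiction refl ne

    K5-rank : ∀ {Y} → Ind M Y → (∀ {e} → e ∈ Y → ∃[ p ] ∃[ q ] (p ≢ q × Joins e (g p) (g q))) → ∣ Y ∣ ≤ 6
    K5-rank ind-Y Y⊆K5 = ≤-trans
      (spanned-card M ind-J ind-Y λ {e} e∈Y → let p , q , ne , e∼ = Y⊆K5 e∈Y in J-spans p q ne {e} e∼) card-J

k4 : ∀ {m} → List (Edge (4 + m))
k4 = ((0F , 1F) , s≤s z≤n) ∷ ((0F , 2F) , s≤s z≤n) ∷ ((0F , 3F) , s≤s z≤n) ∷
     ((1F , 2F) , s≤s (s≤s z≤n)) ∷ ((1F , 3F) , s≤s (s≤s z≤n)) ∷ ((2F , 3F) , s≤s (s≤s (s≤s z≤n))) ∷ []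

k4-unique : ∀ {m} → Unique (k4 {m})
k4-unique =
  ((λ ()) ∷ (λ ()) ∷ (λ ()) ∷ (λ ()) ∷ (λ ()) ∷ []) ∷ ((λ ()) ∷ (λ ()) ∷ (λ ()) ∷ (λ ()) ∷ []) ∷
  ((λ ()) ∷ (λ ()) ∷ (λ ()) ∷ []) ∷ ((λ ()) ∷ (λ ()) ∷ []) ∷ ((λ ()) ∷ []) ∷ [] ∷ []

K4 : ∀ {m} → EdgeSet (4 + m)
K4 = ⟦ k4 ⟧

k4-ends : ∀ {m} {e : Edge (4 + m)} → e ∈ˡ k4 →
          ∃[ p ] ∃[ q ] (p ≢ q × Joins e (p ↑ˡ m) (q ↑ˡ m))
k4-ends (here refl)                                         = 0F , 1F , (λ ()) , inj₁ (refl , refl)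
k4-ends (there (here refl))                                 = 0F , 2F , (λ ()) , inj₁ (refl , refl)
k4-ends (there (there (here refl)))                         = 0F , 3F , (λ ()) , inj₁ (refl , refl)
k4-ends (there (there (there (here refl))))                 = 1F , 2F , (λ ()) , inj₁ (refl , refl)
k4-ends (there (there (there (there (here refl)))))         = 1F , 3F , (λ ()) , inj₁ (refl , refl)
k4-ends (there (there (there (there (there (here refl)))))) = 2F , 3F , (λ ()) , inj₁ (refl , refl)

K4-ends : ∀ {m} {e : Edge (4 + m)} → e ∈ K4 → ∃[ p ] ∃[ q ] (p ≢ q × Joins e (p ↑ˡ m) (q ↑ˡ m))
K4-ends {e = e} e∈ = k4-ends (∈-⟦⟧⁻ {l = k4} {e} e∈)

card-K4 : ∀ m → ∣ K4 {m} ∣ ≡ 6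
card-K4 m = ≤-antisym (card≤length (K4 {m}) {k4} (∈-⟦⟧⁻ {l = k4})) (length≤card (K4 {m}) k4-unique (∈-⟦⟧⁺ {l = k4}))

K4-paving : ∀ {m} → Paving (K4 {m})
K4-paving {m} = paving-of-triangle {e₁ = (0F , 1F) , s≤s z≤n} {(1F , 2F) , s≤s (s≤s z≤n)} {(0F , 2F) , s≤s z≤n}
  (≤-reflexive (card-K4 m)) (inj₁ (refl , refl)) (inj₁ (refl , refl)) (inj₁ (refl , refl)) _ _ _

apex : ∀ {m} → Fin m → Fin 5 → Fin (4 + m)
apex {m} v = quintuple (0F , 1F , 2F , 3F , 4 ↑ʳ v)

apex-injective : ∀ {m} (v : Fin m) → Injective _≡_ _≡_ (apex v)
apex-injective v = Vec.lookup-injective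
  (((λ ()) ∷ (λ ()) ∷ (λ ()) ∷ (λ ()) ∷ []) ∷ ((λ ()) ∷ (λ ()) ∷ (λ ()) ∷ []) ∷
   ((λ ()) ∷ (λ ()) ∷ []) ∷ ((λ ()) ∷ []) ∷ [] ∷ []) _ _

apex-base : ∀ {m} (v : Fin m) (p : Fin 4) → p ↑ˡ m ≡ apex v (p ↑ˡ 1)
apex-base v 0F = refl
apex-base v 1F = refl
apex-base v 2F = refl
apex-base v 3F = refl

-- An edge from the K₄ to a further vertex lies in a K₅ with the K₄; adding it would give seven
-- independent edges there, against `K5-rank`. An edge between two further vertices then completes a
-- K_{2,3} whose other edges are spanned.
K4-spans : ∀ {m} (M : Matroid (4 + m)) → IsK23Matroid M → paving (4 + m) ⪯ M → ∀ e → Spanned M K4 e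
K4-spans {m} M isK above = all-spanned
  where
  ind-K4 : Ind M K4
  ind-K4 = above K4 K4-paving

  to-apex : ∀ p v → SpannedPair M K4 (p ↑ˡ m) (4 ↑ʳ v)
  to-apex p v {e} e∼ e∉K4 ind = contradiction
    (AbovePaving.K5-rank M isK above (apex v) (λ {x} {y} → apex-injective v {x} {y}) ind inside)
    (<⇒≱ (≤-reflexive (trans (cong suc (sym (card-K4 m))) (sym (card-insert e K4 e∉K4)))))
    where
    base≢apex : ∀ p → p ↑ˡ 1 ≢ 4F
    base≢apex 0F ()
    base≢apex 1F ()
    base≢apex 2F ()
    base≢apex 3F ()

    inside : ∀ {e′} → e′ ∈ insert e K4 → ∃[ p ] ∃[ q ] (p ≢ q × Joins e′ (apex v p) (apex v q))
    inside {e′} e′∈ with insert⁻ e K4 {e′} e′∈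
    ... | inj₁ refl = p ↑ˡ 1 , 4F , base≢apex p , subst (λ x → Joins e x _) (apex-base v p) e∼
    ... | inj₂ e′∈K4 with K4-ends {e = e′} e′∈K4
    ...   | q , q′ , ne , e′∼ = q ↑ˡ 1 , q′ ↑ˡ 1 , ne ∘ ↑ˡ-injective 1 q q′ ,
                                subst₂ (Joins e′) (apex-base v q) (apex-base v q′) e′∼

  outside : ∀ {u v} → u ≢ v → SpannedPair M K4 (4 ↑ʳ u) (4 ↑ʳ v)
  outside {u} {v} u≢v = K23-spans M K4 isK ind-K4 {f = f} (λ {x} {y} → f-injective {x} {y})
    (spanned-swap M K4 (to-apex 1F u)) (spanned-swap M K4 (to-apex 2F u))
    (to-apex 0F v)
    (∈⇒spanned M {K4} {(0F , 1F) , s≤s z≤n} _ (inj₁ (refl , refl)))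
    (∈⇒spanned M {K4} {(0F , 2F) , s≤s z≤n} _ (inj₁ (refl , refl)))
    where
    f : Fin 5 → Fin (4 + m)
    -- The parts are {u,0} and {v,1,2}: besides uv, the edges are 01, 02 and three edges between the
    -- K₄ and u or v.
    f = quintuple (4 ↑ʳ u , 0F , 4 ↑ʳ v , 1F , 2F)

    f-injective : Injective _≡_ _≡_ f
    f-injective = Vec.lookup-injective
      (((λ ()) ∷ (u≢v ∘ ↑ʳ-injective 4 u v) ∷ (λ ()) ∷ (λ ()) ∷ []) ∷ ((λ ()) ∷ (λ ()) ∷ (λ ()) ∷ []) ∷
       ((λ ()) ∷ (λ ()) ∷ []) ∷ ((λ ()) ∷ []) ∷ [] ∷ []) _ _

  all-spanned : ∀ e → Spanned M K4 e
  all-spanned ((0F , 1F) , _) e∉ _ = e∉ _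
  all-spanned ((0F , 2F) , _) e∉ _ = e∉ _
  all-spanned ((0F , 3F) , _) e∉ _ = e∉ _
  all-spanned ((1F , 2F) , _) e∉ _ = e∉ _
  all-spanned ((1F , 3F) , _) e∉ _ = e∉ _
  all-spanned ((2F , 3F) , _) e∉ _ = e∉ _
  all-spanned e@((0F , suc (suc (suc (suc v)))) , _) = to-apex 0F v {e} (inj₁ (refl , refl))
  all-spanned e@((1F , suc (suc (suc (suc v)))) , _) = to-apex 1F v {e} (inj₁ (refl , refl))
  all-spanned e@((2F , suc (suc (suc (suc v)))) , _) = to-apex 2F v {e} (inj₁ (refl , refl))
  all-spanned e@((3F , suc (suc (suc (suc v)))) , _) = to-apex 3F v {e} (inj₁ (refl , refl))
  all-spanned e@((suc (suc (suc (suc u))) , suc (suc (suc (suc v)))) , lt) =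
    outside (λ { refl → <-irrefl refl lt }) {e} (inj₁ (refl , refl))
  all-spanned ((suc _ , 1F) , s≤s ())
  all-spanned ((suc (suc _) , 2F) , s≤s (s≤s ()))
  all-spanned ((suc (suc (suc _)) , 3F) , s≤s (s≤s (s≤s ())))

-- In a K_{2,3}-matroid above, the K₄ spans everything, so independent sets have at most six edges;
-- they contain no copy of K_{2,3}, since copies are dependent. These are the two conditions of
-- `Paving`.
paving-maximal : ∀ m → IsMaximalK23 (paving (4 + m))
paving-maximal m = paving-isK23 (4 + m) , above⇒below
  where
  above⇒below : ∀ M → IsK23Matroid M → paving (4 + m) ⪯ M → M ⪯ paving (4 + m)
  above⇒below M isK above X ind-X =
    subst (∣ X ∣ ≤_) (card-K4 m)
      (spanned-card M (above K4 K4-paving) ind-X (λ {e} _ → K4-spans M isK above e)) ,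
    λ (f , inj , K⊆X) → proj₁ (isK f inj) (ind-subset M K⊆X ind-X)

-- Existence of maximal matroids

power : {A : Set} → List A → List (List A)
power []       = [] ∷ []
power (x ∷ xs) = map (x ∷_) (power xs) ++ power xs

-- A filter whose decisions are passed as data, so that it also applies to decisions available only
-- under a double negation.
select : {A : Set} {P : A → Set} (xs : List A) → All (Dec ∘ P) xs →
         ∃[ ys ] (ys ∈ˡ power xs × All P ys × (∀ {x} → x ∈ˡ xs → P x → x ∈ˡ ys))
select []       []          = [] , here refl , [] , λ ()
select (x ∷ xs) (px? ∷ pxs) with select xs pxs | px?
... | ys , ys∈ , all , complete | yes px =
  x ∷ ys , ∈-++⁺ˡ (∈-map⁺ (x ∷_) ys∈) , px ∷ all ,
  λ { (here refl) _ → here refl ; (there z∈) pz → there (complete z∈ pz) }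
... | ys , ys∈ , all , complete | no ¬px =
  ys , ∈-++⁺ʳ (map (x ∷_) (power xs)) ys∈ , all ,
  λ { (here refl) px → contradiction px ¬px ; (there z∈) pz → complete z∈ pz }

-- Excluded middle holds up to double negation, and finitely many such instances can be combined.
¬¬-decidable : {A : Set} {P : A → Set} (xs : List A) → ¬ ¬ All (Dec ∘ P) xs
¬¬-decidable []       ¬all = ¬all []
¬¬-decidable (x ∷ xs) ¬all =
  ¬¬-excluded-middle λ px? → ¬¬-decidable xs λ pxs → ¬all (px? ∷ pxs)

length-filter-≤ : {A : Set} {P Q : A → Set} (P? : ∀ x → Dec (P x)) (Q? : ∀ x → Dec (Q x)) →
                  (∀ {x} → P x → Q x) → ∀ xs → length (filter P? xs) ≤ length (filter Q? xs)
length-filter-≤ P? Q? P⇒Q []       = z≤n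
length-filter-≤ P? Q? P⇒Q (x ∷ xs) with P? x | Q? x
... | yes _  | yes _ = s≤s (length-filter-≤ P? Q? P⇒Q xs)
... | yes px | no ¬q = contradiction (P⇒Q px) ¬q
... | no  _  | yes _ = m≤n⇒m≤1+n (length-filter-≤ P? Q? P⇒Q xs)
... | no  _  | no  _ = length-filter-≤ P? Q? P⇒Q xs

length-filter-< : {A : Set} {P Q : A → Set} (P? : ∀ x → Dec (P x)) (Q? : ∀ x → Dec (Q x)) →
                  (∀ {x} → P x → Q x) → ∀ {xs x} → x ∈ˡ xs → ¬ P x → Q x →
                  length (filter P? xs) < length (filter Q? xs)
length-filter-< P? Q? P⇒Q {x ∷ xs} (here refl) ¬p q with P? x | Q? x
... | yes p | _     = contradiction p ¬p
... | no  _ | yes _ = s≤s (length-filter-≤ P? Q? P⇒Q xs)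
... | no  _ | no ¬q = contradiction q ¬q
length-filter-< P? Q? P⇒Q {x ∷ xs} (there z∈) ¬p q with P? x | Q? x
... | yes _  | yes _ = s≤s (length-filter-< P? Q? P⇒Q z∈ ¬p q)
... | yes px | no ¬q = contradiction (P⇒Q px) ¬q
... | no  _  | yes _ = m≤n⇒m≤1+n (length-filter-< P? Q? P⇒Q z∈ ¬p q)
... | no  _  | no  _ = length-filter-< P? Q? P⇒Q z∈ ¬p q

-- Matroids encoded by finite families of edge lists

subsets : ∀ n → List (List (Edge n))
subsets n = power (allEdges n)

-- Edge sets are functions, so mutual inclusion replaces equality with a listed set.
subset-of : ∀ {n} (X : EdgeSet n) → ∃[ l ] (l ∈ˡ subsets n × X ⊆ ⟦ l ⟧ × ⟦ l ⟧ ⊆ X)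
subset-of {n} X with select (allEdges n) (All.universal (λ e → T? (X e)) (allEdges n))
... | l , l∈ , l⊆X , X⊆l = l , l∈ , (λ e e∈X → ∈-⟦⟧⁺ {l = l} (X⊆l (∈-allEdges e) e∈X)) ,
                           λ e e∈l → All.lookup l⊆X (∈-⟦⟧⁻ {l = l} e∈l)

Family : ℕ → Set
Family n = List (List (Edge n))

-- The downward closure of the family, so that passing to subsets preserves independence by
-- construction.
IndF : ∀ {n} → Family n → EdgeSet n → Set
IndF 𝓕 X = Any (λ l → X ⊆ ⟦ l ⟧) 𝓕

indF? : ∀ {n} (𝓕 : Family n) (X : EdgeSet n) → Dec (IndF 𝓕 X)
indF? 𝓕 X = Any.any? (λ l → X ⊆? ⟦ l ⟧) 𝓕

indF-subset : ∀ {n} {𝓕 : Family n} {X Y} → X ⊆ Y → IndF 𝓕 Y → IndF 𝓕 X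
indF-subset X⊆Y = Any.map λ Y⊆l e e∈X → Y⊆l e (X⊆Y e e∈X)

insert-mono : ∀ {n} (e : Edge n) (X Y : EdgeSet n) → X ⊆ Y → insert e X ⊆ insert e Y
insert-mono e X Y X⊆Y =
  insert-⊆ e X (insert e Y) (insert⁺ˡ e Y) λ e′ e′∈X → insert⁺ʳ e Y e′ (X⊆Y e′ e′∈X)

Augments : ∀ {n} → Family n → List (Edge n) → List (Edge n) → Set
Augments {n} 𝓕 k l = IndF 𝓕 ⟦ k ⟧ → IndF 𝓕 ⟦ l ⟧ → ∣ ⟦ k ⟧ ∣ < ∣ ⟦ l ⟧ ∣ →
                     Any (λ e → e ∈ ⟦ l ⟧ × ¬ (e ∈ ⟦ k ⟧) × IndF 𝓕 (insert e ⟦ k ⟧)) (allEdges n)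

-- Minimality is tested at single deletions only: every proper subset of `C` lies in some `C ─ e`,
-- and `IndF` is closed under subsets.
CircuitF : ∀ {n} → Family n → EdgeSet n → Set
CircuitF {n} 𝓕 C = ¬ IndF 𝓕 C × All (λ e → e ∈ C → IndF 𝓕 (C ─ e)) (allEdges n)

-- All quantifiers range over finite lists, which makes validity decidable.
record Valid {n : ℕ} (𝒞 : List (EdgeSet n)) (S : EdgeSet n) (𝓕 : Family n) : Set where
  constructor valid
  field
    empty    : IndF 𝓕 ∅
    augment  : All (λ k → All (Augments 𝓕 k) (subsets n)) (subsets n)
    circuits : All (CircuitF 𝓕) 𝒞
    S-ind    : IndF 𝓕 S

valid? : ∀ {n} (𝒞 : List (EdgeSet n)) S 𝓕 → Dec (Valid 𝒞 S 𝓕)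
valid? {n} 𝒞 S 𝓕 = map′ (λ (a , b , c , d) → valid a b c d) (λ (valid a b c d) → a , b , c , d)
  (indF? 𝓕 ∅ ×-dec All.all? (λ k → All.all? (augments? k) (subsets n)) (subsets n)
   ×-dec All.all? circuit? 𝒞 ×-dec indF? 𝓕 S)
  where
  augments? : ∀ k l → Dec (Augments 𝓕 k l)
  augments? k l = indF? 𝓕 ⟦ k ⟧ →-dec indF? 𝓕 ⟦ l ⟧ →-dec ∣ ⟦ k ⟧ ∣ <? ∣ ⟦ l ⟧ ∣ →-dec
    Any.any? (λ e → T? (⟦ l ⟧ e) ×-dec ¬? (T? (⟦ k ⟧ e)) ×-dec indF? 𝓕 (insert e ⟦ k ⟧)) (allEdges n)

  circuit? : ∀ C → Dec (CircuitF 𝓕 C)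
  circuit? C = ¬? (indF? 𝓕 C) ×-dec All.all? (λ e → T? (C e) →-dec indF? 𝓕 (C ─ e)) (allEdges n)

generated : ∀ {n} {𝒞 : List (EdgeSet n)} {S 𝓕} → Valid 𝒞 S 𝓕 → Matroid n
generated {n} {𝓕 = 𝓕} v = record
  { Ind = IndF 𝓕
  ; ind-empty = Valid.empty v
  ; ind-subset = indF-subset
  ; ind-augment = augment
  }
  where
  augment : ∀ {X Y} → IndF 𝓕 X → IndF 𝓕 Y → ∣ X ∣ < ∣ Y ∣ →
            ∃[ e ] (e ∈ Y × ¬ (e ∈ X) × IndF 𝓕 (insert e X))
  augment {X} {Y} ind-X ind-Y X<Y with subset-of X | subset-of Y
  ... | k , k∈ , X⊆k , k⊆X | l , l∈ , Y⊆l , l⊆Y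
    with find (All.lookup (All.lookup (Valid.augment v) k∈) l∈
           (indF-subset k⊆X ind-X) (indF-subset l⊆Y ind-Y)
           (≤-trans (s≤s (card-mono ⟦ k ⟧ X k⊆X)) (≤-trans X<Y (card-mono Y ⟦ l ⟧ Y⊆l))))
  ...   | e , _ , e∈l , e∉k , ind =
    e , l⊆Y e e∈l , e∉k ∘ X⊆k e , indF-subset (insert-mono e X ⟦ k ⟧ X⊆k) ind

generated-circuits : ∀ {n} {𝒞 : List (EdgeSet n)} {S 𝓕} (v : Valid 𝒞 S 𝓕) → All (IsCircuit (generated v)) 𝒞
generated-circuits v = All.map
  (λ {C} (dep , minus) → dep , λ X X⊆C (e , e∈C , e∉X) →
    indF-subset (λ e′ e′∈X → ─⁺ C e (X⊆C e′ e′∈X) λ { refl → e∉X e′∈X })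
                (All.lookup minus (∈-allEdges e) e∈C))
  (Valid.circuits v)

Represents : ∀ {n} → Family n → Matroid n → Set
Represents 𝓕 M = ∀ X → (Ind M X → IndF 𝓕 X) × (IndF 𝓕 X → Ind M X)

-- Independence in M need not be decidable, hence the double negation.
¬¬-represented : ∀ {n} (M : Matroid n) → ¬ ¬ (∃[ 𝓕 ] (𝓕 ∈ˡ power (subsets n) × Represents 𝓕 M))
¬¬-represented {n} M none = ¬¬-decidable {P = λ l → Ind M ⟦ l ⟧} (subsets n) λ dec →
  let 𝓕 , 𝓕∈ , sound , complete = select (subsets n) dec
  in none (𝓕 , 𝓕∈ , λ X → to complete X , λ some →
       let l , l∈ , X⊆l = find some in ind-subset M X⊆l (All.lookup sound l∈))
  where
  to : ∀ {𝓕} → (∀ {l} → l ∈ˡ subsets n → Ind M ⟦ l ⟧ → l ∈ˡ 𝓕) → ∀ X → Ind M X → IndF 𝓕 X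
  to complete X ind with subset-of X
  ... | l , l∈ , X⊆l , l⊆X = lose (complete l∈ (ind-subset M l⊆X ind)) X⊆l

represents⇒valid : ∀ {n} (M : Matroid n) {𝒞 : List (EdgeSet n)} {S 𝓕} → All (IsCircuit M) 𝒞 → Ind M S →
                   Represents 𝓕 M → Valid 𝒞 S 𝓕
represents⇒valid {n} M {𝓕 = 𝓕} circ ind-S rep = valid
  (to (ind-empty M))
  (All.universal (λ k → All.universal (augments k) (subsets n)) (subsets n))
  (All.map (λ {C} (dep , proper) → dep ∘ from , All.universal
    (λ e e∈C → to (proper (C ─ e) (λ _ → proj₁ ∘ ─⁻ C e) (e , e∈C , λ e∈ → proj₂ (─⁻ C e e∈) refl)))
    (allEdges n)) circ)
  (to ind-S)
  where
  to : ∀ {X} → Ind M X → IndF 𝓕 X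
  to {X} = proj₁ (rep X)

  from : ∀ {X} → IndF 𝓕 X → Ind M X
  from {X} = proj₂ (rep X)

  augments : ∀ k l → Augments 𝓕 k l
  augments k l ind-k ind-l lt with ind-augment M (from ind-k) (from ind-l) lt
  ... | e , e∈l , e∉k , ind = lose (∈-allEdges e) (e∈l , e∉k , to ind)

-- A valid family with the most independent sets is maximal: a strictly larger competitor would be
-- represented, up to double negation, by a valid family with more of them.
exists-maximal : ∀ {n} (𝒞 : List (EdgeSet n)) (S : EdgeSet n) (M : Matroid n) →
                 All (IsCircuit M) 𝒞 → Ind M S →
                 Σ (Matroid n) λ N → All (IsCircuit N) 𝒞 × Ind N S ×
                   (∀ M′ → All (IsCircuit M′) 𝒞 → N ⪯ M′ → M′ ⪯ N)
exists-maximal {n} 𝒞 S M circ-M ind-S = 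
  generated best-valid , generated-circuits best-valid , Valid.S-ind best-valid , maximal
  where
  families : List (Family n)
  families = power (subsets n)

  some-valid : Any (Valid 𝒞 S) families
  -- Searching the finite list is decidable, so the double negation on the family representing `M`
  -- can be removed.
  some-valid = decidable-stable (Any.any? (valid? 𝒞 S) families) λ none →
    ¬¬-represented M λ (𝓕 , 𝓕∈ , rep) → none (lose 𝓕∈ (represents⇒valid M circ-M ind-S rep))

  size : Family n → ℕ
  -- Counts the independent sets rather than the members of `𝓕`, since different families can have
  -- the same downward closure.
  size 𝓕 = length (filter (λ l → indF? 𝓕 ⟦ l ⟧) (subsets n))

  start : Family n
  -- The default of `argmax` is itself valid, so `best` is valid whichever value is returned.
  start = proj₁ (find some-valid)

  candidates : List (Family n)
  candidates = filter (valid? 𝒞 S) families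

  best : Family n
  best = argmax size start candidates

  best-valid : Valid 𝒞 S best
  best-valid = argmax-all size (proj₂ (proj₂ (find some-valid))) (all-filter (valid? 𝒞 S) families)

  maximal : ∀ M′ → All (IsCircuit M′) 𝒞 → generated best-valid ⪯ M′ → M′ ⪯ generated best-valid
  maximal M′ circ N⪯M′ X ind-X = decidable-stable (indF? best X) λ ¬ind →
    ¬¬-represented M′ λ (𝓕 , 𝓕∈ , rep) →
      let l , l∈ , X⊆l , l⊆X = subset-of X
          -- `S` stays independent above `N`, so the family of `M′` is among the candidates.
          v = represents⇒valid M′ circ (N⪯M′ S (Valid.S-ind best-valid)) rep
      in <⇒≱ (length-filter-< (λ l → indF? best ⟦ l ⟧) (λ l → indF? 𝓕 ⟦ l ⟧)
                (λ {l} ind → proj₁ (rep ⟦ l ⟧) (N⪯M′ ⟦ l ⟧ ind)) l∈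
                (¬ind ∘ indF-subset X⊆l) (indF-subset l⊆X (proj₁ (rep X) ind-X)))
             (All.lookup (f[xs]≤f[argmax] {f = size} start candidates) (∈-filter⁺ (valid? 𝒞 S) 𝓕∈ v))

-- The two maximal matroids

K23-circuits⁺ : ∀ {n} (M : Matroid n) → IsK23Matroid M → All (IsCircuit M) (K23s n)
K23-circuits⁺ M isK = All.tabulate λ C∈ → let f , inj , eq = ∈-K23s⁻ C∈ in
  subst (IsCircuit M) (sym eq) (isK f inj)

K23-circuits⁻ : ∀ {n} (M : Matroid n) → All (IsCircuit M) (K23s n) → IsK23Matroid M
K23-circuits⁻ M all f inj = All.lookup all (∈-K23s⁺ inj)

theorem5p3 : (n : ℕ) → 7 ≤ n →
    Σ (Matroid n) (λ M₁ → Σ (Matroid n) (λ M₂ →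
    IsMaximalK23 M₁ × IsMaximalK23 M₂ × ¬ ((M₁ ⪯ M₂) × (M₂ ⪯ M₁))))
theorem5p3 _ (s≤s (s≤s (s≤s (s≤s (s≤s (s≤s (s≤s (z≤n {m})))))))) =
  let N , circuits , ind-S , maximal =
        exists-maximal (K23s (7 + m)) star⁺ (bicircular (7 + m) zero)
          (K23-circuits⁺ (bicircular (7 + m) zero) (bicircular-isK23 (7 + m) zero)) star⁺-bicircular
  in paving (7 + m) , N , paving-maximal (3 + m) ,
     (K23-circuits⁻ N circuits , λ M isK → maximal M (K23-circuits⁺ M isK)) ,
     -- `star⁺` is independent in `N` and has at least seven edges, but independent sets of `paving`
     -- have at most six.
     λ (_ , N⪯paving) → <⇒≱ (card-star⁺ {m}) (proj₁ (N⪯paving star⁺ ind-S))
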